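{- Let $s\ge 2$ be an integer and let $T_t$ be a tree of order $t$. If either (i) $\ell(T_t)\ge s+1$, or (ii) $t>7(s-2)$, then $r_{pot}(K_s,T_t)=t+s-2$.
   Context: All graphs are finite and simple. A sequence of nonnegative integers $\pi=(d_1,\dots,d_n)$ (always taken nonincreasing) is graphic if some graph of order $n$ has degree sequence $\pi$; such a graph is a realization of $\pi$. For a graph $H$, a graphic sequence $\pi$ is potentially $H$-graphic if some realization of $\pi$ contains $H$ as a subgraph. For an $N$-term sequence $\pi=(d_1,\dots,d_N)$, the complementary sequence is $\overline{\pi}=(N-1-d_N,\dots,N-1-d_1)$. For graphs $H_1,H_2$, the potential-Ramsey number $r_{pot}(H_1,H_2)$ is the minimum integer $N$ such that for every $N$-term graphic sequence $\pi$, either $\pi$ is potentially $H_1$-graphic or $\overline{\pi}$ is potentially $H_2$-graphic. $K_s$ is the complete graph on $s$ vertices, and $\ell(T)$ denotes the number of leaves (degree-1 vertices) of a tree $T$. -}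

module Defs where

open import Data.Nat using (ℕ; zero; suc; _+_; _∸_; _≤_; _<_)
open import Data.Fin using (Fin; zero; suc; inject₁; fromℕ; opposite; _≟_)
import Data.Fin as F
open import Data.Bool using (Bool; true; false; not; if_then_else_)
open import Data.Product using (Σ; ∃; _×_; _,_)
open import Data.Sum using (_⊎_)
open import Relation.Nullary using (¬_; yes; no; does)
open import Relation.Binary.PropositionalEquality using (_≡_; refl)
open import Function.Definitions using (Injective)

count : ∀ {n} → (Fin n → Bool) → ℕ
count {zero}  p = 0
count {suc n} p = (if p zero then 1 else 0) + count (λ i → p (suc i))

record Graph (n : ℕ) : Set where
  field
    adj    : Fin n → Fin n → Bool
    sym    : ∀ i j → adj i j ≡ adj j i
    irrefl : ∀ i → adj i i ≡ false
open Graph public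

deg : ∀ {n} → Graph n → Fin n → ℕ
deg G i = count (adj G i)

K : (s : ℕ) → Graph s
K s = record { adj = λ i j → not (does (i ≟ j)) ; sym = symK ; irrefl = irrK }
  where
  symK : ∀ i j → not (does (i ≟ j)) ≡ not (does (j ≟ i))
  symK i j with i ≟ j | j ≟ i
  ... | yes _ | yes _ = refl
  ... | no _  | no _  = refl
  ... | yes refl | no n = Data.Empty.⊥-elim (n refl)
    where import Data.Empty
  ... | no n | yes refl = Data.Empty.⊥-elim (n refl)
    where import Data.Empty
  irrK : ∀ i → not (does (i ≟ i)) ≡ false
  irrK i with i ≟ i
  ... | yes _ = refl
  ... | no n = Data.Empty.⊥-elim (n refl)
    where import Data.Empty

Contains : ∀ {h n} → Graph h → Graph n → Set
Contains {h} {n} H G =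
  Σ (Fin h → Fin n) λ f → Injective _≡_ _≡_ f ×
    (∀ u v → adj H u v ≡ true → adj G (f u) (f v) ≡ true)

data Reach {n} (G : Graph n) : Fin n → Fin n → Set where
  here : ∀ {u} → Reach G u u
  step : ∀ {u w v} → adj G u w ≡ true → Reach G w v → Reach G u v

Connected : ∀ {n} → Graph n → Set
Connected {n} G = ∀ (u v : Fin n) → Reach G u v

HasCycle : ∀ {n} → Graph n → Set
HasCycle {n} G = Σ ℕ λ m → Σ (Fin (suc (suc (suc m))) → Fin n) λ f →
  Injective _≡_ _≡_ f ×
  (∀ (i : Fin (suc (suc m))) → adj G (f (inject₁ i)) (f (suc i)) ≡ true) ×
  (adj G (f (fromℕ (suc (suc m)))) (f zero) ≡ true)

IsTree : ∀ {n} → Graph n → Set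
IsTree G = Connected G × ¬ HasCycle G

leaves : ∀ {n} → Graph n → ℕ
leaves G = count (λ i → does (deg G i Data.Nat.≟ 1))
  where import Data.Nat

-- degree sequences as functions Fin N → ℕ (d_1 = π zero, ...)
Nonincreasing : ∀ {N} → (Fin N → ℕ) → Set
Nonincreasing {N} π = ∀ (i j : Fin N) → i F.≤ j → π j ≤ π i

Realization : ∀ {N} → (Fin N → ℕ) → Graph N → Set
Realization {N} π G = ∀ (i : Fin N) → deg G i ≡ π i

Graphic : ∀ {N} → (Fin N → ℕ) → Set
Graphic {N} π = Σ (Graph N) λ G → Realization π G

PotentiallyGraphic : ∀ {h N} → Graph h → (Fin N → ℕ) → Set
PotentiallyGraphic {h} {N} H π =
  Σ (Graph N) λ G → Realization π G × Contains H G

complementSeq : ∀ {N} → (Fin N → ℕ) → Fin N → ℕ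
complementSeq {N} π i = (N ∸ 1) ∸ π (opposite i)

RamseyProp : ∀ {h₁ h₂} → Graph h₁ → Graph h₂ → ℕ → Set
RamseyProp H₁ H₂ N = ∀ (π : Fin N → ℕ) → Nonincreasing π → Graphic π →
  PotentiallyGraphic H₁ π ⊎ PotentiallyGraphic H₂ (complementSeq π)

RPotEq : ∀ {h₁ h₂} → Graph h₁ → Graph h₂ → ℕ → Set
RPotEq H₁ H₂ N = RamseyProp H₁ H₂ N × (∀ M → M < N → ¬ RamseyProp H₁ H₂ M)

{-# OPTIONS --safe #-}
-- Write k = s − 2 and N = k + t.  For the lower bound take the join of K_k with independent vertices.
--
-- For the upper bound let d_1 ≥ … ≥ d_N.  A variant of the Tripathi–Venugopalan–West proof of the
-- Erdős–Gallai theorem gives a realization with a clique on the s largest degrees as soon as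
-- d_s ≥ s − 1 and (d_{2s} ≥ s − 1 or d_{s+1} ≥ 2s − 2).  So without K_s we have d_{2s} ≤ k and
-- d_{s+1} ≤ 2k + 1.
--
-- Now T is embedded in the complement, leaf by leaf from an inner root, at fixed places: the k
-- largest degrees are left out, then come the leaves of T, then an independent set J of vertices
-- far from the leaves, then the rest.  When the new vertex b' is adjacent to its parent b in the
-- realization, pick c with d(c) ≥ d(b') that is neither adjacent to b nor the place of a tree
-- neighbour of b; an exchange replaces b b' by b c.  Such a c exists by counting, because parents
-- have degree ≤ k, or ≤ 2k + 1 if they lie in J.  Leaves and J together must have at least k + 3
-- elements: J is empty if T has s + 1 leaves, and otherwise a colour class of T provides it since
-- t ≥ 2k + 5.
module Submission where

open import Defs
open import Data.Nat using (ℕ; zero; suc; _+_; _*_; _∸_; _≤_; _<_; z≤n; s≤s; _⊓_; _≤?_; _<?_)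
open import Data.Nat.Properties hiding (_≟_)
open import Data.Nat.Tactic.RingSolver using (solve-∀)
open import Data.Fin using (Fin; zero; suc; toℕ; fromℕ; fromℕ<; inject₁; opposite; _≟_)
open import Data.Fin.Properties using (any?; toℕ<n; toℕ-injective; toℕ-fromℕ<; opposite-involutive; injective⇒≤)
open import Data.Fin.Permutation using (reverse)
open import Data.Bool using (Bool; true; false; not; if_then_else_; _∧_; _∨_)
import Data.Bool.Properties as Bool
open import Data.Product using (∃; _×_; _,_; proj₁; proj₂)
open import Data.Sum using (_⊎_; inj₁; inj₂; [_,_])
import Data.Sum as Sum
open import Data.Empty using (⊥; ⊥-elim)
open import Data.List using (List; []; _∷_; _++_; length; lookup)
open import Data.List.Membership.Propositional using (_∈_; _∉_)
open import Data.List.Membership.Propositional.Properties using (∈-++⁻; ∈-lookup)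
open import Data.List.Relation.Unary.Any using (here; there)
open import Function using (_∘_; id)
open import Function.Definitions using (Injective)
open import Relation.Nullary using (¬_; Dec; yes; no; does; contradiction)
open import Relation.Nullary.Decidable using (dec-true; dec-false; _×-dec_; ¬?; decidable-stable)
open import Relation.Binary.Definitions using (tri<; tri≈; tri>)
open import Relation.Binary.PropositionalEquality using (_≡_; _≢_; refl; cong; cong₂; trans; subst; subst₂; module ≡-Reasoning) renaming (sym to ≡-sym)
open import Algebra.Properties.CommutativeMonoid.Sum +-0-commutativeMonoid using (sum; sum-cong-≗; ∑-distrib-+; ∑-comm; sum-permute)

-- Counting and summation

-- Both thresholds of the clique part come from one obstruction. The clique edges are put in first
-- and kept, and the later vertices are saturated in order. If each clique vertex has a neighbour
-- beyond the current vertex n, the classical comparison with a given realization ends the argument.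
-- Otherwise let Q be the vertices from index s to n, q in number, let ρ clique vertices have no
-- neighbour beyond n, let d_{s+1} = s - 1 + ε, and let E count the edges from Q to the vertices
-- after n. Counting at Q gives (q - ρ)(q - ε) + E < 0, while q ≥ ε. This is impossible when ε ≥ s -
-- 1, and also when the first 2s degrees are at least s - 1, because these make E large. In the
-- embedding, leaves of T are never parents, so they may take places where nothing is known about
-- degrees. After k skipped places and k + 3 places for leaves and J, the others have 0-based index
-- at least 2k + 3 = 2s - 1, where degrees are at most k. A vertex of J has all its tree neighbours
-- there; so any of the 2k + 3 earlier places can serve as c, and at most 2k + 2 of them are its
-- neighbours or itself.

farkas : ∀ {x y p q} c → x ≤ y → p + y + c ≡ q + x → p ≤ q
farkas {x} {y} {p} {q} c x≤y eq = +-cancelʳ-≤ y p q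
  (≤-trans (m≤m+n (p + y) c) (≤-trans (≤-reflexive eq) (+-monoʳ-≤ q x≤y)))

does⇒ : ∀ {A : Set} (d : Dec A) → does d ≡ true → A
does⇒ (yes a) _ = a

does⇏ : ∀ {A : Set} (d : Dec A) → does d ≡ false → ¬ A
does⇏ (no ¬a) _ = ¬a

∧⇒ : ∀ {a b} → a ∧ b ≡ true → a ≡ true × b ≡ true
∧⇒ {true} {true} _ = refl , refl

⇒∧ : ∀ {a b} → a ≡ true → b ≡ true → a ∧ b ≡ true
⇒∧ refl refl = refl

∨⇒ : ∀ {a b} → a ∨ b ≡ true → a ≡ true ⊎ b ≡ true
∨⇒ {true}  _ = inj₁ refl
∨⇒ {false} e = inj₂ e

∨-false : ∀ {a b} → a ∨ b ≡ false → a ≡ false × b ≡ false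
∨-false {false} {false} _ = refl , refl

not⇒ : ∀ {a} → not a ≡ true → a ≡ false
not⇒ {false} _ = refl

≢true : ∀ {a} → a ≢ true → a ≡ false
≢true {true}  h = contradiction refl h
≢true {false} _ = refl

true≢false : ∀ {a} → a ≡ true → a ≡ false → ⊥
true≢false refl ()

𝟙 : Bool → ℕ
𝟙 b = if b then 1 else 0

sum-mono-≤ : ∀ {n} {f g : Fin n → ℕ} → (∀ i → f i ≤ g i) → sum f ≤ sum g
sum-mono-≤ {zero}  h = z≤n
sum-mono-≤ {suc n} h = +-mono-≤ (h zero) (sum-mono-≤ (h ∘ suc))

sum-mono-< : ∀ {n} {f g : Fin n → ℕ} → (∀ i → f i ≤ g i) → ∀ i → f i < g i → sum f < sum g
sum-mono-< h zero    lt = +-mono-<-≤ lt (sum-mono-≤ (h ∘ suc))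
sum-mono-< h (suc i) lt = +-mono-≤-< (h zero) (sum-mono-< (h ∘ suc) i lt)

count≡sum : ∀ {n} (p : Fin n → Bool) → count p ≡ sum (𝟙 ∘ p)
count≡sum {zero}  p = refl
count≡sum {suc n} p = cong (𝟙 (p zero) +_) (count≡sum (p ∘ suc))

count-cong : ∀ {n} (p q : Fin n → Bool) → (∀ i → p i ≡ q i) → count p ≡ count q
count-cong {zero}  p q h = refl
count-cong {suc n} p q h = cong₂ _+_ (cong 𝟙 (h zero)) (count-cong (p ∘ suc) (q ∘ suc) (h ∘ suc))

count-none : ∀ {n} (p : Fin n → Bool) → (∀ i → p i ≡ false) → count p ≡ 0
count-none {zero}  p h = refl
count-none {suc n} p h rewrite h zero = count-none (p ∘ suc) (h ∘ suc)

count-all : ∀ {n} (p : Fin n → Bool) → (∀ i → p i ≡ true) → count p ≡ n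
count-all {zero}  p h = refl
count-all {suc n} p h rewrite h zero = cong suc (count-all (p ∘ suc) (h ∘ suc))

count-+ : ∀ {n} (p q r : Fin n → Bool) → (∀ i → 𝟙 (p i) ≡ 𝟙 (q i) + 𝟙 (r i)) →
          count p ≡ count q + count r
count-+ {n} p q r h = begin
  count p                       ≡⟨ count≡sum p ⟩
  sum (𝟙 ∘ p)                   ≡⟨ sum-cong-≗ h ⟩
  sum (λ i → 𝟙 (q i) + 𝟙 (r i)) ≡⟨ ∑-distrib-+ (𝟙 ∘ q) (𝟙 ∘ r) ⟩
  sum (𝟙 ∘ q) + sum (𝟙 ∘ r)     ≡⟨ cong₂ _+_ (count≡sum q) (count≡sum r) ⟨
  count q + count r             ∎
  where open ≡-Reasoning

count-∪ : ∀ {n} (p q r : Fin n → Bool) →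
          (∀ i → p i ≡ true → q i ≡ true ⊎ r i ≡ true) → count p ≤ count q + count r
count-∪ p q r h = subst₂ _≤_ (≡-sym (count≡sum p))
  (trans (∑-distrib-+ (𝟙 ∘ q) (𝟙 ∘ r)) (≡-sym (cong₂ _+_ (count≡sum q) (count≡sum r))))
  (sum-mono-≤ pointwise)
  where
  pointwise : ∀ i → 𝟙 (p i) ≤ 𝟙 (q i) + 𝟙 (r i)
  pointwise i with p i in eq
  ... | false = z≤n
  ... | true with h i eq
  ...   | inj₁ qi rewrite qi = s≤s z≤n
  ...   | inj₂ ri rewrite ri = m≤n+m 1 (𝟙 (q i))

count-mono : ∀ {n} (p q : Fin n → Bool) → (∀ i → p i ≡ true → q i ≡ true) → count p ≤ count q
count-mono p q h = subst₂ _≤_ (≡-sym (count≡sum p)) (≡-sym (count≡sum q)) (sum-mono-≤ pointwise)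
  where
  pointwise : ∀ i → 𝟙 (p i) ≤ 𝟙 (q i)
  pointwise i with p i in eq
  ... | false = z≤n
  ... | true rewrite h i eq = ≤-refl

count-mono-< : ∀ {n} (p q : Fin n → Bool) → (∀ i → p i ≡ true → q i ≡ true) →
               ∀ i → q i ≡ true → p i ≡ false → count p < count q
count-mono-< p q h i qi pi = subst₂ _<_ (≡-sym (count≡sum p)) (≡-sym (count≡sum q))
  (sum-mono-< pointwise i (subst₂ _<_ (cong 𝟙 (≡-sym pi)) (cong 𝟙 (≡-sym qi)) (s≤s z≤n)))
  where
  pointwise : ∀ i → 𝟙 (p i) ≤ 𝟙 (q i)
  pointwise i with p i in eq
  ... | false = z≤n
  ... | true rewrite h i eq = ≤-refl

count-≤n : ∀ {n} (p : Fin n → Bool) → count p ≤ n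
count-≤n {n} p = ≤-trans (count-mono p (λ _ → true) (λ _ _ → refl)) (≤-reflexive (count-all {n} _ (λ _ → refl)))

count-split : ∀ {n} (p q : Fin n → Bool) →
              count p ≡ count (λ i → q i ∧ p i) + count (λ i → not (q i) ∧ p i)
count-split p q = count-+ p _ _ pointwise
  where
  pointwise : ∀ i → 𝟙 (p i) ≡ 𝟙 (q i ∧ p i) + 𝟙 (not (q i) ∧ p i)
  pointwise i with q i
  ... | true  = ≡-sym (+-identityʳ _)
  ... | false = refl

is : ∀ {n} → Fin n → Fin n → Bool
is i j = does (j ≟ i)

is-refl : ∀ {n} (i : Fin n) → is i i ≡ true
is-refl i = dec-true (i ≟ i) refl

is-≢ : ∀ {n} {i j : Fin n} → j ≢ i → is i j ≡ false
is-≢ {i = i} {j} = dec-false (j ≟ i)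

is-comm : ∀ {n} (i j : Fin n) → is i j ≡ is j i
is-comm i j with i ≟ j
... | yes refl = is-refl i
... | no i≢j   = is-≢ {i = i} {j} (λ e → i≢j (≡-sym e))

count-is : ∀ {n} (i : Fin n) → count (is i) ≡ 1
count-is {suc n} zero    = cong suc (count-none {n} _ (λ _ → refl))
count-is {suc n} (suc i) = count-is i

count-pos : ∀ {n} (p : Fin n → Bool) i → p i ≡ true → 1 ≤ count p
count-pos p i pi = subst (_≤ count p) (count-is i)
  (count-mono (is i) p (λ j eq → subst (λ k → p k ≡ true) (≡-sym (does⇒ (j ≟ i) eq)) pi))

∈∖ : ∀ {n} (p q : Fin n → Bool) → Dec (∃ λ i → p i ≡ true × q i ≡ false)
∈∖ p q = any? (λ i → (p i Bool.≟ true) ×-dec (q i Bool.≟ false))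

∉∖⇒⊆ : ∀ {n} (p q : Fin n → Bool) → ¬ (∃ λ i → p i ≡ true × q i ≡ false) →
       ∀ i → p i ≡ true → q i ≡ true
∉∖⇒⊆ p q h i pi with q i in eq
... | true  = refl
... | false = contradiction (i , pi , eq) h

count-<⇒∖ : ∀ {n} (p q : Fin n → Bool) → count q < count p → ∃ λ i → p i ≡ true × q i ≡ false
count-<⇒∖ p q lt with ∈∖ p q
... | yes w = w
... | no ¬w = contradiction (count-mono p q (∉∖⇒⊆ p q ¬w)) (<⇒≱ lt)

count-≤⇒∖ : ∀ {n} (p q : Fin n → Bool) → count q ≤ count p →
            ∀ j → q j ≡ true → p j ≡ false → ∃ λ i → p i ≡ true × q i ≡ false
count-≤⇒∖ p q le j qj pj with ∈∖ p q
... | yes w = w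
... | no ¬w = contradiction (count-mono-< p q (∉∖⇒⊆ p q ¬w) j qj pj) (≤⇒≯ le)

count-pos⇒∃ : ∀ {n} (p : Fin n → Bool) → 1 ≤ count p → ∃ λ i → p i ≡ true
count-pos⇒∃ {n} p le =
  let i , pi , _ = count-<⇒∖ p (λ _ → false) (subst (_< count p) (≡-sym (count-none {n} _ (λ _ → refl))) le)
  in i , pi

below : ∀ {n} → ℕ → Fin n → Bool
below k i = does (toℕ i <? k)

below-⇐ : ∀ {n k} {i : Fin n} → toℕ i < k → below k i ≡ true
below-⇐ {k = k} {i} = dec-true (toℕ i <? k)

below-⇒ : ∀ {n k} {i : Fin n} → below k i ≡ true → toℕ i < k
below-⇒ {k = k} {i} = does⇒ (toℕ i <? k)

below-⇏ : ∀ {n k} {i : Fin n} → below k i ≡ false → k ≤ toℕ i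
below-⇏ {k = k} {i} h = ≮⇒≥ (does⇏ (toℕ i <? k) h)

count-below : ∀ n k → k ≤ n → count {n} (below k) ≡ k
count-below n       zero    z≤n     = count-none {n} (below 0) (λ i → dec-false (toℕ i <? 0) λ ())
count-below (suc n) (suc k) (s≤s h) = cong suc (count-below n k h)

between : ∀ {n} → ℕ → ℕ → Fin n → Bool
between l u i = below u i ∧ not (below l i)

between-⇐ : ∀ {n l u} (i : Fin n) → l ≤ toℕ i → toℕ i < u → between l u i ≡ true
between-⇐ {l = l} {u} i h h' =
  ⇒∧ (below-⇐ {k = u} {i} h') (cong not (dec-false (toℕ i <? l) (≤⇒≯ h)))

between-⇒ : ∀ {n l u} (i : Fin n) → between l u i ≡ true → l ≤ toℕ i × toℕ i < u
between-⇒ {l = l} {u} i h =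
  let iu , il = ∧⇒ {below u i} h in below-⇏ {k = l} {i} (not⇒ il) , below-⇒ {k = u} {i} iu

count-between : ∀ n l u → l ≤ u → u ≤ n → l + count {n} (between l u) ≡ u
count-between n l u l≤u u≤n = begin
  l + count {n} (between l u)                   ≡⟨ cong (λ x → x + count {n} (between l u)) (count-below n l (≤-trans l≤u u≤n)) ⟨
  count {n} (below l) + count {n} (between l u) ≡⟨ count-+ {n} (below u) (below l) (between l u) pointwise ⟨
  count {n} (below u)                           ≡⟨ count-below n u u≤n ⟩
  u                                             ∎
  where
  open ≡-Reasoning
  pointwise : ∀ (i : Fin n) → 𝟙 (below u i) ≡ 𝟙 (below l i) + 𝟙 (between l u i)
  pointwise i with below u i in p | below l i in q
  ... | true  | true  = refl
  ... | true  | false = refl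
  ... | false | false = refl
  ... | false | true  = contradiction (<-≤-trans (below-⇒ {k = l} {i} q) l≤u) (≤⇒≯ (below-⇏ {k = u} {i} p))

sumOn : ∀ {n} → (Fin n → Bool) → (Fin n → ℕ) → ℕ
sumOn p f = sum (λ i → if p i then f i else 0)

sumOn-mono : ∀ {n} (p : Fin n → Bool) {f g : Fin n → ℕ} →
             (∀ i → p i ≡ true → f i ≤ g i) → sumOn p f ≤ sumOn p g
sumOn-mono p {f} {g} h = sum-mono-≤ pointwise
  where
  pointwise : ∀ i → (if p i then f i else 0) ≤ (if p i then g i else 0)
  pointwise i with p i in eq
  ... | true  = h i eq
  ... | false = z≤n

sumOn-cong : ∀ {n} (p : Fin n → Bool) {f g : Fin n → ℕ} →
             (∀ i → p i ≡ true → f i ≡ g i) → sumOn p f ≡ sumOn p g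
sumOn-cong p h = ≤-antisym (sumOn-mono p (λ i pi → ≤-reflexive (h i pi)))
                           (sumOn-mono p (λ i pi → ≤-reflexive (≡-sym (h i pi))))

sumOn-mono-< : ∀ {n} (p : Fin n → Bool) {f g : Fin n → ℕ} →
               (∀ i → p i ≡ true → f i ≤ g i) → ∀ i → p i ≡ true → f i < g i → sumOn p f < sumOn p g
sumOn-mono-< p {f} {g} h i pi lt = sum-mono-< pointwise i strict
  where
  pointwise : ∀ i → (if p i then f i else 0) ≤ (if p i then g i else 0)
  pointwise i with p i in eq
  ... | true  = h i eq
  ... | false = z≤n
  strict : (if p i then f i else 0) < (if p i then g i else 0)
  strict rewrite pi = lt

sumOn-+ : ∀ {n} (p : Fin n → Bool) (f g : Fin n → ℕ) →
          sumOn p (λ i → f i + g i) ≡ sumOn p f + sumOn p g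
sumOn-+ p f g = trans (sum-cong-≗ pointwise)
  (∑-distrib-+ (λ i → if p i then f i else 0) (λ i → if p i then g i else 0))
  where
  pointwise : ∀ i → (if p i then f i + g i else 0) ≡ (if p i then f i else 0) + (if p i then g i else 0)
  pointwise i with p i
  ... | true  = refl
  ... | false = refl

sumOn-const : ∀ {n} (p : Fin n → Bool) c → sumOn p (λ _ → c) ≡ count p * c
sumOn-const {zero}  p c = refl
sumOn-const {suc n} p c with p zero
... | true  = cong (c +_) (sumOn-const (p ∘ suc) c)
... | false = sumOn-const (p ∘ suc) c

nbrs : ∀ {n} → Graph n → (Fin n → Bool) → Fin n → ℕ
nbrs G p i = count (λ j → p j ∧ adj G i j)

double-count : ∀ {n} (G : Graph n) (p q : Fin n → Bool) → sumOn p (nbrs G q) ≡ sumOn q (nbrs G p)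
double-count {n} G p q = begin
  sumOn p (nbrs G q)                                  ≡⟨ expand p q ⟩
  sum (λ i → sum (λ j → 𝟙 (p i ∧ (q j ∧ adj G i j)))) ≡⟨ ∑-comm (λ i j → 𝟙 (p i ∧ (q j ∧ adj G i j))) ⟩
  sum (λ j → sum (λ i → 𝟙 (p i ∧ (q j ∧ adj G i j)))) ≡⟨ sum-cong-≗ (λ j → sum-cong-≗ (λ i → cong 𝟙 (swap i j))) ⟩
  sum (λ j → sum (λ i → 𝟙 (q j ∧ (p i ∧ adj G j i)))) ≡⟨ expand q p ⟨
  sumOn q (nbrs G p)                                  ∎
  where
  open ≡-Reasoning
  expand : ∀ (p q : Fin n → Bool) →
           sumOn p (nbrs G q) ≡ sum (λ i → sum (λ j → 𝟙 (p i ∧ (q j ∧ adj G i j))))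
  expand p q = sum-cong-≗ pointwise
    where
    pointwise : ∀ i → (if p i then nbrs G q i else 0) ≡ sum (λ j → 𝟙 (p i ∧ (q j ∧ adj G i j)))
    pointwise i with p i
    ... | true  = count≡sum (λ j → q j ∧ adj G i j)
    ... | false = trans (≡-sym (count-none {n} _ (λ _ → refl))) (count≡sum {n} (λ _ → false))
  swap : ∀ i j → p i ∧ (q j ∧ adj G i j) ≡ q j ∧ (p i ∧ adj G j i)
  swap i j rewrite Graph.sym G i j with p i | q j
  ... | true  | true  = refl
  ... | true  | false = refl
  ... | false | true  = refl
  ... | false | false = refl

count-is∧ : ∀ {n} (p : Fin n → Bool) a → count (λ i → is a i ∧ p i) ≡ 𝟙 (p a)
count-is∧ p a with p a in eq
... | true  = trans (count-cong _ (is a) on-true) (count-is a)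
  where
  on-true : ∀ i → is a i ∧ p i ≡ is a i
  on-true i with i ≟ a
  ... | yes refl = eq
  ... | no _     = refl
... | false = count-none _ on-false
  where
  on-false : ∀ i → is a i ∧ p i ≡ false
  on-false i with i ≟ a
  ... | yes refl = eq
  ... | no _     = refl

count-remove : ∀ {n} (p : Fin n → Bool) a → count p ≡ 𝟙 (p a) + count (λ i → not (is a i) ∧ p i)
count-remove p a = trans (count-split p (is a)) (cong (_+ count (λ i → not (is a i) ∧ p i)) (count-is∧ p a))

-- Editing a graph

adj-≢ : ∀ {n} (G : Graph n) {i j} → adj G i j ≡ true → i ≢ j
adj-≢ G {i} e refl = true≢false e (irrefl G i)

adj-sym : ∀ {n} (G : Graph n) {i j v} → adj G i j ≡ v → adj G j i ≡ v
adj-sym G {i} {j} e = trans (Graph.sym G j i) e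

-- The edge `a b`, if present, counts once in each degree, so discarding both ends keeps the strict
-- inequality between the neighbourhoods.
private-nbr : ∀ {n} (G : Graph n) {a b} → a ≢ b → deg G b < deg G a →
              ∃ λ z → adj G a z ≡ true × z ≢ b × adj G b z ≡ false
private-nbr G {a} {b} a≢b lt =
  let z , pz , qz = count-<⇒∖ (λ i → not (is b i) ∧ adj G a i) (λ i → not (is a i) ∧ adj G b i) lt'
      zb , az = ∧⇒ {not (is b z)} pz
      z≢b = does⇏ (z ≟ b) (not⇒ zb)
      z≢a = λ z≡a → adj-≢ G az (≡-sym z≡a)
  in z , az , z≢b , trans (cong (λ v → not v ∧ adj G b z) (≡-sym (is-≢ z≢a))) qz
  where
  lt' : count (λ i → not (is a i) ∧ adj G b i) < count (λ i → not (is b i) ∧ adj G a i)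
  lt' = +-cancelˡ-< (𝟙 (adj G a b)) _ _ (subst₂ _<_
    (trans (count-remove (adj G b) a) (cong (λ v → 𝟙 v + count (λ i → not (is a i) ∧ adj G b i)) (Graph.sym G b a)))
    (count-remove (adj G a) b) lt)

pair : ∀ {n} → Fin n → Fin n → Fin n → Fin n → Bool
pair a b i j = (is a i ∧ is b j) ∨ (is b i ∧ is a j)

pair-sym : ∀ {n} (a b i j : Fin n) → pair a b i j ≡ pair a b j i
pair-sym a b i j = trans (Bool.∨-comm (is a i ∧ is b j) (is b i ∧ is a j))
  (cong₂ _∨_ (Bool.∧-comm (is b i) (is a j)) (Bool.∧-comm (is a i) (is b j)))

pair-true : ∀ {n} {a b i j : Fin n} → pair a b i j ≡ true → (i ≡ a × j ≡ b) ⊎ (i ≡ b × j ≡ a)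
pair-true {a = a} {b} {i} {j} e with is a i ∧ is b j in e₁
... | true  = let x , y = ∧⇒ {is a i} e₁ in inj₁ (does⇒ (i ≟ a) x , does⇒ (j ≟ b) y)
... | false = let x , y = ∧⇒ {is b i} e in inj₂ (does⇒ (i ≟ b) x , does⇒ (j ≟ a) y)

pair-refl : ∀ {n} (a b : Fin n) → pair a b a b ≡ true
pair-refl a b rewrite is-refl a | is-refl b = refl

pair-off : ∀ {n} {a b i j : Fin n} → ¬ ((i ≡ a × j ≡ b) ⊎ (i ≡ b × j ≡ a)) → pair a b i j ≡ false
pair-off h = ≢true (λ e → h (pair-true e))

set : ∀ {n} (G : Graph n) (a b : Fin n) → a ≢ b → Bool → Graph n
adj (set G a b _ v) i j = if pair a b i j then v else adj G i j
Graph.sym (set G a b _ v) i j rewrite pair-sym a b i j = cong (if pair a b j i then v else_) (Graph.sym G i j)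
irrefl (set G a b a≢b v) i
  rewrite pair-off {a = a} {b} {i} {i} [ (λ (p , q) → a≢b (trans (≡-sym p) q)) , (λ (p , q) → a≢b (trans (≡-sym q) p)) ]
  = irrefl G i

module _ {n} (G : Graph n) {a b : Fin n} (a≢b : a ≢ b) where

  set-at : ∀ v → adj (set G a b a≢b v) a b ≡ v
  set-at v rewrite pair-refl a b = refl

  set-off : ∀ {v i j} → ¬ ((i ≡ a × j ≡ b) ⊎ (i ≡ b × j ≡ a)) → adj (set G a b a≢b v) i j ≡ adj G i j
  set-off h rewrite pair-off h = refl

  count-pair : ∀ i → count (pair a b i) ≡ 𝟙 (is a i) + 𝟙 (is b i)
  count-pair i with i ≟ a | i ≟ b
  ... | yes refl | yes refl = contradiction refl a≢b
  ... | yes refl | no _     = trans (count-cong _ (is b) (λ j → Bool.∨-identityʳ _)) (count-is b)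
  ... | no _     | yes refl = count-is a
  ... | no _     | no _     = count-none {n} _ (λ _ → refl)

  deg-add : adj G a b ≡ false → ∀ i → deg (set G a b a≢b true) i ≡ deg G i + (𝟙 (is a i) + 𝟙 (is b i))
  deg-add h i = trans (count-+ _ (adj G i) (pair a b i) pointwise) (cong (deg G i +_) (count-pair i))
    where
    pointwise : ∀ j → 𝟙 (adj (set G a b a≢b true) i j) ≡ 𝟙 (adj G i j) + 𝟙 (pair a b i j)
    pointwise j with pair a b i j in e
    ... | false = ≡-sym (+-identityʳ _)
    ... | true with pair-true {a = a} {b} {i} {j} e
    ...   | inj₁ (refl , refl) rewrite h = refl
    ...   | inj₂ (refl , refl) rewrite adj-sym G h = refl

  deg-remove : adj G a b ≡ true → ∀ i → deg (set G a b a≢b false) i + (𝟙 (is a i) + 𝟙 (is b i)) ≡ deg G i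
  deg-remove h i = ≡-sym (trans (count-+ (adj G i) _ (pair a b i) pointwise)
                                (cong (deg (set G a b a≢b false) i +_) (count-pair i)))
    where
    pointwise : ∀ j → 𝟙 (adj G i j) ≡ 𝟙 (adj (set G a b a≢b false) i j) + 𝟙 (pair a b i j)
    pointwise j with pair a b i j in e
    ... | false = ≡-sym (+-identityʳ _)
    ... | true with pair-true {a = a} {b} {i} {j} e
    ...   | inj₁ (refl , refl) rewrite h = refl
    ...   | inj₂ (refl , refl) rewrite adj-sym G h = refl

-- Swings the edge `y z` around `y` to `y x`. The exchanges below are chains of such rotations and
-- of single added or removed edges. In `rotate-deg` the losing vertex stands on the left, which
-- avoids truncated subtraction.
module Rotate {n} (G : Graph n) {y z x : Fin n} (y≢x : y ≢ x)
              (yz : adj G y z ≡ true) (yx : adj G y x ≡ false) where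

  private
    y≢z = adj-≢ G yz
    z≢x : z ≢ x
    z≢x refl = true≢false yz yx
    G₁ = set G y z y≢z false

    off : ∀ {i j} → j ≢ z → j ≢ y → ¬ ((i ≡ y × j ≡ z) ⊎ (i ≡ z × j ≡ y))
    off p q = [ (λ (_ , e) → p e) , (λ (_ , e) → q e) ]

    yx₁ : adj G₁ y x ≡ false
    yx₁ = trans (set-off G y≢z (off (λ e → z≢x (≡-sym e)) (λ e → y≢x (≡-sym e)))) yx

  rotate : Graph n
  rotate = set G₁ y x y≢x true

  rotate-deg : ∀ i → deg rotate i + 𝟙 (is z i) ≡ deg G i + 𝟙 (is x i)
  rotate-deg i = begin
    deg rotate i + Z       ≡⟨ cong (_+ Z) (deg-add G₁ y≢x yx₁ i) ⟩
    D + (Y + X) + Z        ≡⟨ arith D Y X Z ⟩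
    D + (Y + Z) + X        ≡⟨ cong (_+ X) (deg-remove G y≢z yz i) ⟩
    deg G i + X            ∎
    where
    open ≡-Reasoning
    D = deg G₁ i
    Y = 𝟙 (is y i)
    X = 𝟙 (is x i)
    Z = 𝟙 (is z i)
    arith : ∀ d y x z → d + (y + x) + z ≡ d + (y + z) + x
    arith = solve-∀

  rotate-away : ∀ {i j} → i ≢ y → j ≢ y → adj rotate i j ≡ adj G i j
  rotate-away p q = trans (set-off G₁ y≢x [ (λ (e , _) → p e) , (λ (_ , e) → q e) ])
                          (set-off G y≢z [ (λ (e , _) → p e) , (λ (_ , e) → q e) ])

  rotate-old : adj rotate y z ≡ false
  rotate-old = trans (set-off G₁ y≢x [ (λ (_ , e) → z≢x e) , (λ (e , _) → y≢x e) ]) (set-at G y≢z false)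

  rotate-false : ∀ {i j} → ¬ ((i ≡ y × j ≡ x) ⊎ (i ≡ x × j ≡ y)) → adj G i j ≡ false → adj rotate i j ≡ false
  rotate-false {i} {j} off e = trans (set-off G₁ y≢x off) removed
    where
    removed : adj G₁ i j ≡ false
    removed with pair y z i j
    ... | true  = refl
    ... | false = e

-- Graphs with a clique at the front and an independent set at the back

CliqueOn : ∀ {n} → ℕ → Graph n → Set
CliqueOn s G = ∀ i j → toℕ i < s → toℕ j < s → i ≢ j → adj G i j ≡ true

-- The strict bound leaves the edges between the vertex at index `r` and the later ones free: they
-- are needed to fill that vertex.
IndepAfter : ∀ {n} → ℕ → Graph n → Set
IndepAfter r G = ∀ i j → r < toℕ i → r < toℕ j → adj G i j ≡ false

Split : ∀ {n} → ℕ → ℕ → Graph n → Set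
Split s r G = CliqueOn s G × IndepAfter r G

split-add : ∀ {n s r} (G : Graph n) {a b} (a≢b : a ≢ b) → toℕ a ≤ r ⊎ toℕ b ≤ r →
            Split s r G → Split s r (set G a b a≢b true)
split-add {n} {s} {r} G {a} {b} a≢b le (clique , indep) = clique' , indep'
  where
  clique' : CliqueOn s (set G a b a≢b true)
  clique' i j p q i≢j with pair a b i j
  ... | true  = refl
  ... | false = clique i j p q i≢j
  indep' : IndepAfter r (set G a b a≢b true)
  indep' i j p q with pair a b i j in e
  ... | false = indep i j p q
  ... | true with pair-true {a = a} {b} {i} {j} e
  ...   | inj₁ (refl , refl) = [ (λ h → contradiction p (≤⇒≯ h)) , (λ h → contradiction q (≤⇒≯ h)) ] le
  ...   | inj₂ (refl , refl) = [ (λ h → contradiction q (≤⇒≯ h)) , (λ h → contradiction p (≤⇒≯ h)) ] le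

split-remove : ∀ {n s r} (G : Graph n) {a b} (a≢b : a ≢ b) → s ≤ toℕ a ⊎ s ≤ toℕ b →
               Split s r G → Split s r (set G a b a≢b false)
split-remove {n} {s} {r} G {a} {b} a≢b le (clique , indep) = clique' , indep'
  where
  indep' : IndepAfter r (set G a b a≢b false)
  indep' i j p q with pair a b i j
  ... | true  = refl
  ... | false = indep i j p q
  clique' : CliqueOn s (set G a b a≢b false)
  clique' i j p q i≢j with pair a b i j in e
  ... | false = clique i j p q i≢j
  ... | true with pair-true {a = a} {b} {i} {j} e
  ...   | inj₁ (refl , refl) = [ (λ h → contradiction p (≤⇒≯ h)) , (λ h → contradiction q (≤⇒≯ h)) ] le
  ...   | inj₂ (refl , refl) = [ (λ h → contradiction q (≤⇒≯ h)) , (λ h → contradiction p (≤⇒≯ h)) ] le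

split-rotate : ∀ {n s r} (G : Graph n) {y z x} (y≢x : y ≢ x) (yz : adj G y z ≡ true) (yx : adj G y x ≡ false) →
               s ≤ toℕ y ⊎ s ≤ toℕ z → toℕ y ≤ r ⊎ toℕ x ≤ r →
               Split s r G → Split s r (Rotate.rotate G y≢x yz yx)
split-rotate G y≢x yz yx hs hr sp = split-add (set G _ _ (adj-≢ G yz) false) y≢x hr
  (split-remove G (adj-≢ G yz) hs sp)

-- Induction that splits off the first row and the first column of the adjacency matrix: they
-- contribute equally by symmetry, and the diagonal vanishes.
sum-degrees-even : ∀ {n} (G : Graph n) → ∃ λ m → sum (deg G) ≡ m + m
sum-degrees-even {n} G =
  let m , eq = even n (λ i j → 𝟙 (adj G i j)) (λ i j → cong 𝟙 (Graph.sym G i j)) (λ i → cong 𝟙 (irrefl G i))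
  in m , trans (sum-cong-≗ (λ i → count≡sum (adj G i))) eq
  where
  even : ∀ n (f : Fin n → Fin n → ℕ) → (∀ i j → f i j ≡ f j i) → (∀ i → f i i ≡ 0) →
         ∃ λ m → sum (λ i → sum (f i)) ≡ m + m
  even zero    f s d = 0 , refl
  even (suc n) f s d =
    let m , eq = even n (λ i j → f (suc i) (suc j)) (λ i j → s (suc i) (suc j)) (λ i → d (suc i))
        row = sum (λ j → f zero (suc j))
    in row + m , (begin
      (f zero zero + row) + sum (λ i → f (suc i) zero + sum (λ j → f (suc i) (suc j)))
        ≡⟨ cong₂ (λ u v → u + row + v) (d zero)
             (∑-distrib-+ (λ i → f (suc i) zero) (λ i → sum (λ j → f (suc i) (suc j)))) ⟩
      row + (sum (λ i → f (suc i) zero) + sum (λ i → sum (λ j → f (suc i) (suc j))))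
        ≡⟨ cong₂ (λ u v → row + (u + v)) (sum-cong-≗ (λ i → s (suc i) zero)) eq ⟩
      row + (row + (m + m))
        ≡⟨ arith row m ⟩
      (row + m) + (row + m) ∎)
    where
    open ≡-Reasoning
    arith : ∀ r m → r + (r + (m + m)) ≡ (r + m) + (r + m)
    arith = solve-∀

-- Realizations with a clique on the s largest degrees

-- Turns an attempt at each vertex into a dichotomy: either some exchange succeeds and is returned,
-- or its obstruction holds at every vertex and becomes available to the next stage.
scan : ∀ n {B : Set} {P : Fin n → Set} → (∀ i → B ⊎ P i) → B ⊎ (∀ i → P i)
scan zero    f = inj₂ λ ()
scan (suc n) f with f zero
... | inj₁ b = inj₁ b
... | inj₂ p with scan n (f ∘ suc)
...   | inj₁ b = inj₁ b
...   | inj₂ q = inj₂ λ { zero → p ; (suc i) → q i }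

set-true : ∀ {n} (G : Graph n) {a b} (a≢b : a ≢ b) {i j} →
           adj G i j ≡ true → adj (set G a b a≢b true) i j ≡ true
set-true G {a} {b} a≢b {i} {j} e with pair a b i j
... | true  = refl
... | false = e

nbrs-full : ∀ {n} (G : Graph n) p i → (∀ j → p j ≡ true → adj G i j ≡ true) → nbrs G p i ≡ count p
nbrs-full G p i h = ≤-antisym (count-mono _ p (λ j e → proj₁ (∧⇒ {p j} e)))
                              (count-mono p _ (λ j e → ⇒∧ e (h j e)))

nbrs-none : ∀ {n} (G : Graph n) p i → (∀ j → p j ≡ true → adj G i j ≡ false) → nbrs G p i ≡ 0
nbrs-none G p i h = count-none _ (λ j → ≢true (λ e → let pj , ij = ∧⇒ {p j} e in true≢false ij (h j pj)))

nbrs-clique : ∀ {n} (G : Graph n) p i → p i ≡ true → (∀ j → p j ≡ true → j ≢ i → adj G i j ≡ true) →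
              suc (nbrs G p i) ≡ count p
nbrs-clique G p i pi h = begin
  suc (nbrs G p i)                             ≡⟨ cong suc (count-cong _ _ same) ⟩
  suc (count (λ j → not (is i j) ∧ p j))       ≡⟨ cong (λ v → 𝟙 v + count (λ j → not (is i j) ∧ p j)) pi ⟨
  𝟙 (p i) + count (λ j → not (is i j) ∧ p j)   ≡⟨ count-remove p i ⟨
  count p                                      ∎
  where
  open ≡-Reasoning
  same : ∀ j → p j ∧ adj G i j ≡ not (is i j) ∧ p j
  same j with j ≟ i
  ... | yes refl = trans (cong (p j ∧_) (irrefl G j)) (Bool.∧-zeroʳ (p j))
  ... | no j≢i with p j in pj
  ...   | true  = h j pj j≢i
  ...   | false = refl

nbrs-< : ∀ {n} (G : Graph n) p i → p i ≡ true → nbrs G p i < count p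
nbrs-< G p i pi = count-mono-< _ p (λ j e → proj₁ (∧⇒ {p j} e)) i pi
  (trans (cong (p i ∧_) (irrefl G i)) (Bool.∧-zeroʳ (p i)))

nbrs-≤deg : ∀ {n} (G : Graph n) p i → nbrs G p i ≤ deg G i
nbrs-≤deg G p i = count-mono _ (adj G i) (λ j e → proj₂ (∧⇒ {p j} e))

nbrs-≤count : ∀ {n} (G : Graph n) p i → nbrs G p i ≤ count p
nbrs-≤count G p i = count-mono _ p (λ j e → proj₁ (∧⇒ {p j} e))

nbrs-split : ∀ {n} (G : Graph n) p q r i → (∀ j → 𝟙 (p j) ≡ 𝟙 (q j) + 𝟙 (r j)) →
             nbrs G p i ≡ nbrs G q i + nbrs G r i
nbrs-split G p q r i h = count-+ _ _ _ pointwise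
  where
  pointwise : ∀ j → 𝟙 (p j ∧ adj G i j) ≡ 𝟙 (q j ∧ adj G i j) + 𝟙 (r j ∧ adj G i j)
  pointwise j with adj G i j
  ... | true  = trans (cong 𝟙 (Bool.∧-identityʳ (p j))) (trans (h j)
                  (≡-sym (cong₂ _+_ (cong 𝟙 (Bool.∧-identityʳ (q j))) (cong 𝟙 (Bool.∧-identityʳ (r j))))))
  ... | false rewrite Bool.∧-zeroʳ (p j) | Bool.∧-zeroʳ (q j) | Bool.∧-zeroʳ (r j) = refl

-- The subrealizations in the Erdős–Gallai proof of Tripathi, Venugopalan and West (r is their
-- critical index), with the extra requirement that the first s vertices form a clique.
record Inv {N} (π : Fin N → ℕ) (s r : ℕ) (H : Graph N) : Set where
  constructor inv
  field
    split : Split s r H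
    deg≤  : ∀ i → deg H i ≤ π i
    sat   : ∀ i → toℕ i < r → deg H i ≡ π i

-- Exchanges that raise the degree of the current vertex `n`

module Moves {N} (π : Fin N → ℕ) (mono : Nonincreasing π) (G₀ : Graph N) (R₀ : Realization π G₀)
             (s : ℕ) (n : Fin N) (s≤r : s ≤ toℕ n)
             (H : Graph N) (I : Inv π s (toℕ n) H) (deficient : deg H n < π n) where

  open Inv I

  r : ℕ
  r = toℕ n

  -- Progress is measured at `n` alone. Later vertices may lose edges; those before `n` have to stay
  -- saturated.
  Better : Set
  Better = ∃ λ H' → Inv π s r H' × deg H n < deg H' n

  <r⇒≢n : ∀ {c} → toℕ c < r → c ≢ n
  <r⇒≢n lt refl = <-irrefl refl lt

  >r⇒≢n : ∀ {c} → r < toℕ c → c ≢ n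
  >r⇒≢n lt refl = <-irrefl refl lt

  >r⇒≢ : ∀ {w i : Fin N} → r < toℕ w → toℕ i < r → i ≢ w
  >r⇒≢ p q refl = <-asym p q

  -- One of three net effects to which the exchanges are reduced. Here a later vertex `w` cedes one
  -- unit of degree to `n`; in `join` both `n` and a deficient `w` gain one; in `double` the vertex
  -- `n` gains two.
  shift : ∀ H' w → r < toℕ w → Split s r H' →
          (∀ i → deg H' i + 𝟙 (is w i) ≡ deg H i + 𝟙 (is n i)) → Better
  shift H' w r<w sp eq = H' , inv sp bound sat' , ≤-reflexive (≡-sym at-n)
    where
    at-n : deg H' n ≡ suc (deg H n)
    at-n = begin
      deg H' n               ≡⟨ +-identityʳ _ ⟨
      deg H' n + 0           ≡⟨ cong (λ v → deg H' n + 𝟙 v) (is-≢ (λ e → >r⇒≢n r<w (≡-sym e))) ⟨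
      deg H' n + 𝟙 (is w n)  ≡⟨ eq n ⟩
      deg H n + 𝟙 (is n n)   ≡⟨ cong (λ v → deg H n + 𝟙 v) (is-refl n) ⟩
      deg H n + 1            ≡⟨ +-comm (deg H n) 1 ⟩
      suc (deg H n)          ∎
      where open ≡-Reasoning
    away : ∀ i → i ≢ n → deg H' i + 𝟙 (is w i) ≡ deg H i
    away i i≢n = trans (eq i) (trans (cong (λ v → deg H i + 𝟙 v) (is-≢ i≢n)) (+-identityʳ _))
    bound : ∀ i → deg H' i ≤ π i
    bound i with i ≟ n
    ... | yes refl = subst (_≤ π n) (≡-sym at-n) deficient
    ... | no i≢n   = ≤-trans (≤-trans (m≤m+n _ _) (≤-reflexive (away i i≢n))) (deg≤ i)
    sat' : ∀ i → toℕ i < r → deg H' i ≡ π i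
    sat' i i<r = trans (≡-sym (+-identityʳ _)) (trans
      (cong (λ v → deg H' i + 𝟙 v) (≡-sym (is-≢ (>r⇒≢ r<w i<r))))
      (trans (away i (<r⇒≢n i<r)) (sat i i<r)))

  join : ∀ H' w → r < toℕ w → deg H w < π w → Split s r H' →
         (∀ i → deg H' i ≡ deg H i + (𝟙 (is n i) + 𝟙 (is w i))) → Better
  join H' w r<w unsat sp eq = H' , inv sp bound sat' , ≤-reflexive (≡-sym at-n)
    where
    n≢w : n ≢ w
    n≢w e = >r⇒≢n r<w (≡-sym e)
    at-n : deg H' n ≡ suc (deg H n)
    at-n rewrite eq n | is-refl n | is-≢ n≢w = +-comm (deg H n) 1
    at-w : deg H' w ≡ suc (deg H w)
    at-w rewrite eq w | is-refl w | is-≢ (>r⇒≢n r<w) = +-comm (deg H w) 1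
    away : ∀ i → i ≢ n → i ≢ w → deg H' i ≡ deg H i
    away i p q rewrite eq i | is-≢ p | is-≢ q = +-identityʳ _
    bound : ∀ i → deg H' i ≤ π i
    bound i with i ≟ n | i ≟ w
    ... | yes refl | _        = subst (_≤ π n) (≡-sym at-n) deficient
    ... | no _     | yes refl = subst (_≤ π w) (≡-sym at-w) unsat
    ... | no p     | no q     = subst (_≤ π i) (≡-sym (away i p q)) (deg≤ i)
    sat' : ∀ i → toℕ i < r → deg H' i ≡ π i
    sat' i i<r = trans (away i (<r⇒≢n i<r) (>r⇒≢ r<w i<r)) (sat i i<r)

  -- Otherwise `n` would be the only unsaturated vertex, and the degree sums of `H` and `G₀` would
  -- differ by 1 although both are even.
  unsaturated : π n ≡ suc (deg H n) → ∃ λ w → r < toℕ w × deg H w < π w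
  unsaturated def1 with any? (λ w → (r <? toℕ w) ×-dec (deg H w <? π w))
  ... | yes w = w
  ... | no ¬w = contradiction parity (even≢odd m₀ m₁)
    where
    open ≡-Reasoning
    m₀ = proj₁ (sum-degrees-even G₀)
    m₁ = proj₁ (sum-degrees-even H)
    total : ∀ i → deg H i + 𝟙 (is n i) ≡ deg G₀ i
    total i with <-cmp (toℕ i) r
    ... | tri< lt _ _ rewrite is-≢ (<r⇒≢n lt) = trans (+-identityʳ _) (trans (sat i lt) (≡-sym (R₀ i)))
    ... | tri≈ _ e _ rewrite toℕ-injective e | is-refl n = trans (+-comm _ 1) (trans (≡-sym def1) (≡-sym (R₀ n)))
    ... | tri> _ _ gt rewrite is-≢ (>r⇒≢n gt) = trans (+-identityʳ _)
          (trans (≤-antisym (deg≤ i) (≮⇒≥ (λ lt → ¬w (i , gt , lt)))) (≡-sym (R₀ i)))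
    parity : 2 * m₀ ≡ suc (2 * m₁)
    parity = begin
      2 * m₀                                  ≡⟨ cong (m₀ +_) (+-identityʳ m₀) ⟩
      m₀ + m₀                                 ≡⟨ proj₂ (sum-degrees-even G₀) ⟨
      sum (deg G₀)                            ≡⟨ sum-cong-≗ total ⟨
      sum (λ i → deg H i + 𝟙 (is n i))        ≡⟨ ∑-distrib-+ (deg H) (λ i → 𝟙 (is n i)) ⟩
      sum (deg H) + sum (λ i → 𝟙 (is n i))    ≡⟨ cong₂ _+_ (proj₂ (sum-degrees-even H))
                                                   (trans (≡-sym (count≡sum (is n))) (count-is n)) ⟩
      m₁ + m₁ + 1                             ≡⟨ +-comm (m₁ + m₁) 1 ⟩
      suc (m₁ + m₁)                           ≡⟨ cong (λ v → suc (m₁ + v)) (+-identityʳ m₁) ⟨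
      suc (2 * m₁)                            ∎

  -- If n has deficiency 1, then by parity some later vertex is deficient too; it gives back one edge.
  double : ∀ H' → Split s r H' → (∀ i → deg H' i ≡ deg H i + (𝟙 (is n i) + 𝟙 (is n i))) →
           (∀ w → r < toℕ w → deg H w < π w → adj H' n w ≡ true) → Better
  double H' sp eq nw with suc (deg H n) <? π n
  ... | yes def2 = H' , inv sp bound sat' , subst (deg H n <_) (≡-sym at-n) (m≤n⇒m≤1+n ≤-refl)
    where
    at-n : deg H' n ≡ suc (suc (deg H n))
    at-n rewrite eq n | is-refl n = +-comm (deg H n) 2
    away : ∀ i → i ≢ n → deg H' i ≡ deg H i
    away i p rewrite eq i | is-≢ p = +-identityʳ _
    bound : ∀ i → deg H' i ≤ π i
    bound i with i ≟ n
    ... | yes refl = subst (_≤ π n) (≡-sym at-n) def2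
    ... | no p     = subst (_≤ π i) (≡-sym (away i p)) (deg≤ i)
    sat' : ∀ i → toℕ i < r → deg H' i ≡ π i
    sat' i i<r = trans (away i (<r⇒≢n i<r)) (sat i i<r)
  ... | no ¬def2 =
    let w , r<w , lt = unsaturated (≤-antisym (≮⇒≥ ¬def2) deficient)
        n~w = nw w r<w lt
        n≢w = adj-≢ H' n~w
    in shift (set H' n w n≢w false) w r<w
         (split-remove H' n≢w (inj₁ s≤r) sp)
         (λ i → +-cancelʳ-≡ (𝟙 (is n i)) _ _ (begin
            deg (set H' n w n≢w false) i + 𝟙 (is w i) + 𝟙 (is n i)   ≡⟨ swap (deg (set H' n w n≢w false) i) _ _ ⟩
            deg (set H' n w n≢w false) i + (𝟙 (is n i) + 𝟙 (is w i)) ≡⟨ deg-remove H' n≢w n~w i ⟩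
            deg H' i                                                 ≡⟨ eq i ⟩
            deg H i + (𝟙 (is n i) + 𝟙 (is n i))                      ≡⟨ +-assoc (deg H i) _ _ ⟨
            deg H i + 𝟙 (is n i) + 𝟙 (is n i)                        ∎))
    where
    open ≡-Reasoning
    swap : ∀ a b c → a + b + c ≡ a + (c + b)
    swap = solve-∀

  -- A vertex before `n` is saturated, so its degree is at least `π n` and exceeds that of `n`. The
  -- private neighbour found here is the `z` of the exchanges that follow.
  outer : ∀ c → toℕ c < r → ∃ λ z → adj H c z ≡ true × z ≢ n × adj H n z ≡ false
  outer c c<r = private-nbr H (<r⇒≢n c<r)
    (<-≤-trans deficient (subst (π n ≤_) (≡-sym (sat c c<r)) (mono c n (<⇒≤ c<r))))

  Later : Set
  Later = ∀ w → r < toℕ w → deg H w < π w → adj H n w ≡ true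

  later : Better ⊎ Later
  later = scan N move
    where
    move : ∀ w → Better ⊎ (r < toℕ w → deg H w < π w → adj H n w ≡ true)
    move w with r <? toℕ w | deg H w <? π w | adj H n w in e
    ... | no p  | _     | _     = inj₂ λ h → contradiction h p
    ... | yes _ | no q  | _     = inj₂ λ _ h → contradiction h q
    ... | yes _ | yes _ | true  = inj₂ λ _ _ → refl
    ... | yes p | yes q | false = inj₁ (join (set H n w n≢w true) w p q
          (split-add H n≢w (inj₁ ≤-refl) split) (deg-add H n≢w e))
      where
      n≢w : n ≢ w
      n≢w e = >r⇒≢n p (≡-sym e)

  module _ (F₁ : Later) where

    Earlier : Set
    Earlier = ∀ x → s ≤ toℕ x → toℕ x < r → adj H x n ≡ true

    -- If `x n` is missing, `x z` gives way to `x n` and `n z`: then `n` gains two and no other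
    -- degree changes. Should this be one too many, `double` removes an edge from `n` to a deficient
    -- later vertex, and `keeps` ensures that this edge is still there.
    earlier : Better ⊎ Earlier
    earlier = scan N move
      where
      move : ∀ x → Better ⊎ (s ≤ toℕ x → toℕ x < r → adj H x n ≡ true)
      move x with s ≤? toℕ x | toℕ x <? r | adj H x n in e
      ... | no p  | _     | _     = inj₂ λ h → contradiction h p
      ... | yes _ | no q  | _     = inj₂ λ _ h → contradiction h q
      ... | yes _ | yes _ | true  = inj₂ λ _ _ → refl
      ... | yes s≤x | yes x<r | false with outer x x<r
      ...   | z , xz , z≢n , nz = inj₁ (double (set rotate n z n≢z true) sp degs keeps)
        where
        x≢n = <r⇒≢n x<r
        n≢z : n ≢ z
        n≢z e = z≢n (≡-sym e)
        open Rotate H {x} {z} {n} x≢n xz e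
        nz' : adj rotate n z ≡ false
        nz' = trans (rotate-away (λ e → x≢n (≡-sym e)) (λ e → adj-≢ H xz (≡-sym e))) nz
        sp : Split s r (set rotate n z n≢z true)
        sp = split-add rotate n≢z (inj₁ ≤-refl)
               (split-rotate H x≢n xz e (inj₁ s≤x) (inj₁ (<⇒≤ x<r)) split)
        degs : ∀ i → deg (set rotate n z n≢z true) i ≡ deg H i + (𝟙 (is n i) + 𝟙 (is n i))
        degs i = trans (deg-add rotate n≢z nz' i) (trans (arith (deg rotate i) _ _)
          (trans (cong (_+ 𝟙 (is n i)) (rotate-deg i)) (+-assoc (deg H i) _ _)))
          where
          arith : ∀ a b c → a + (b + c) ≡ a + c + b
          arith = solve-∀
        keeps : ∀ w → r < toℕ w → deg H w < π w → adj (set rotate n z n≢z true) n w ≡ true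
        keeps w r<w lt = set-true rotate n≢z {n} {w}
          (trans (rotate-away (λ e → x≢n (≡-sym e)) (λ e → >r⇒≢ r<w x<r (≡-sym e))) (F₁ w r<w lt))

  -- The edge `c z` gives way to `z n`, and `c` makes up its loss with `c w`. The last hypothesis
  -- ensures that `c z` is not an edge of the clique.
  attach : ∀ {c w z} → toℕ c < r → r < toℕ w → deg H w < π w → adj H c w ≡ false →
           adj H c z ≡ true → z ≢ n → adj H n z ≡ false → s ≤ toℕ c ⊎ s ≤ toℕ z → Better
  attach {c} {w} {z} c<r r<w lt cw cz z≢n nz le = join (set rotate c w c≢w true) w r<w lt
    (split-add rotate c≢w (inj₁ (<⇒≤ c<r))
      (split-rotate H z≢n zc zn ([ inj₂ , inj₁ ] le) (inj₂ ≤-refl) split)) degs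
    where
    zc = adj-sym H cz
    zn = adj-sym H nz
    c≢w : c ≢ w
    c≢w = >r⇒≢ r<w c<r
    open Rotate H {z} {c} {n} z≢n zc zn
    cw' : adj rotate c w ≡ false
    cw' = trans (rotate-away (adj-≢ H cz) (λ { refl → true≢false cz cw })) cw
    degs : ∀ i → deg (set rotate c w c≢w true) i ≡ deg H i + (𝟙 (is n i) + 𝟙 (is w i))
    degs i = trans (deg-add rotate c≢w cw' i) (trans (≡-sym (+-assoc (deg rotate i) _ _))
      (trans (cong (_+ 𝟙 (is w i)) (rotate-deg i)) (+-assoc (deg H i) _ _)))

  Attached : Set
  Attached = ∀ w → r < toℕ w → deg H w < π w → ∀ x → s ≤ toℕ x → toℕ x < r → adj H x w ≡ true

  attached : Better ⊎ Attached
  attached = scan N λ w → test w (r <? toℕ w) (deg H w <? π w)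
    where
    test : ∀ w → Dec (r < toℕ w) → Dec (deg H w < π w) →
            Better ⊎ (r < toℕ w → deg H w < π w → ∀ x → s ≤ toℕ x → toℕ x < r → adj H x w ≡ true)
    test w (no p)    _        = inj₂ λ h → contradiction h p
    test w (yes _)   (no q)   = inj₂ λ _ h → contradiction h q
    test w (yes r<w) (yes lt) with scan N move
      where
      move : ∀ x → Better ⊎ (s ≤ toℕ x → toℕ x < r → adj H x w ≡ true)
      move x with s ≤? toℕ x | toℕ x <? r | adj H x w in e
      ... | no p  | _     | _     = inj₂ λ h → contradiction h p
      ... | yes _ | no q  | _     = inj₂ λ _ h → contradiction h q
      ... | yes _ | yes _ | true  = inj₂ λ _ _ → refl
      ... | yes s≤x | yes x<r | false with outer x x<r
      ...   | z , xz , z≢n , nz = inj₁ (attach x<r r<w lt e xz z≢n nz (inj₁ s≤x))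
    ... | inj₁ b = inj₁ b
    ... | inj₂ f = inj₂ λ _ _ → f

  Linked : Set
  Linked = ∀ c w → toℕ c < r → r < toℕ w → adj H c w ≡ true →
           ∀ x → s ≤ toℕ x → toℕ x ≤ r → x ≢ c → adj H c x ≡ true

  -- A missing `c n` replaces `c w` at once. A missing `c x` with `x` before `n` also replaces
  -- `c w`; then `x` has one edge too many and passes it on, `x z` becoming `z n`. Either way one
  -- unit of degree moves from `w` to `n`.
  linked : Better ⊎ Linked
  linked = scan N λ c → scan N λ w → inner c w (toℕ c <? r) (r <? toℕ w) (adj H c w) refl
    where
    inner : ∀ c w → Dec (toℕ c < r) → Dec (r < toℕ w) → ∀ v → adj H c w ≡ v →
            Better ⊎ (toℕ c < r → r < toℕ w → adj H c w ≡ true →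
                      ∀ x → s ≤ toℕ x → toℕ x ≤ r → x ≢ c → adj H c x ≡ true)
    inner c w (no p)    _       _     _ = inj₂ λ h → contradiction h p
    inner c w (yes _)   (no q)  _     _ = inj₂ λ _ h → contradiction h q
    inner c w (yes _)   (yes _) false e = inj₂ λ _ _ e' → ⊥-elim (true≢false e' e)
    inner c w (yes c<r) (yes r<w) true cw with scan N move
      where
      c≢n = <r⇒≢n c<r
      s≤w : s ≤ toℕ w
      s≤w = ≤-trans s≤r (<⇒≤ r<w)
      to-n : adj H c n ≡ false → Better
      to-n cn = shift (Rotate.rotate H c≢n cw cn) w r<w
        (split-rotate H c≢n cw cn (inj₂ s≤w) (inj₂ ≤-refl) split) (Rotate.rotate-deg H c≢n cw cn)
      to-x : ∀ x → s ≤ toℕ x → toℕ x < r → x ≢ c → adj H c x ≡ false → Better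
      to-x x s≤x x<r x≢c cx = shift R₂.rotate w r<w sp degs
        where
        c≢x : c ≢ x
        c≢x e = x≢c (≡-sym e)
        o = outer x x<r
        z = proj₁ o
        xz = proj₁ (proj₂ o)
        z≢n = proj₁ (proj₂ (proj₂ o))
        nz = proj₂ (proj₂ (proj₂ o))
        module R₁ = Rotate H {c} {w} {x} c≢x cw cx
        z≢c : z ≢ c
        z≢c z≡c = true≢false (subst (λ v → adj H x v ≡ true) z≡c xz) (adj-sym H cx)
        zx₁ : adj R₁.rotate z x ≡ true
        zx₁ = trans (R₁.rotate-away z≢c x≢c) (adj-sym H xz)
        zn₁ : adj R₁.rotate z n ≡ false
        zn₁ = trans (R₁.rotate-away z≢c (λ e → c≢n (≡-sym e))) (adj-sym H nz)
        module R₂ = Rotate R₁.rotate {z} {x} {n} z≢n zx₁ zn₁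
        sp : Split s r R₂.rotate
        sp = split-rotate R₁.rotate z≢n zx₁ zn₁ (inj₂ s≤x) (inj₂ ≤-refl)
               (split-rotate H c≢x cw cx (inj₂ s≤w) (inj₁ (<⇒≤ c<r)) split)
        degs : ∀ i → deg R₂.rotate i + 𝟙 (is w i) ≡ deg H i + 𝟙 (is n i)
        degs i = +-cancelʳ-≡ (𝟙 (is x i)) _ _ (begin
          deg R₂.rotate i + W + X   ≡⟨ swap (deg R₂.rotate i) W X ⟩
          deg R₂.rotate i + X + W   ≡⟨ cong (_+ W) (R₂.rotate-deg i) ⟩
          deg R₁.rotate i + M + W   ≡⟨ swap (deg R₁.rotate i) M W ⟩
          deg R₁.rotate i + W + M   ≡⟨ cong (_+ M) (R₁.rotate-deg i) ⟩
          deg H i + X + M           ≡⟨ swap (deg H i) X M ⟩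
          deg H i + M + X           ∎)
          where
          open ≡-Reasoning
          W = 𝟙 (is w i)
          X = 𝟙 (is x i)
          M = 𝟙 (is n i)
          swap : ∀ a b c → a + b + c ≡ a + c + b
          swap = solve-∀
      move : ∀ x → Better ⊎ (s ≤ toℕ x → toℕ x ≤ r → x ≢ c → adj H c x ≡ true)
      move x with s ≤? toℕ x | toℕ x ≤? r | x ≟ c | adj H c x in e
      ... | no p  | _     | _     | _     = inj₂ λ h → contradiction h p
      ... | yes _ | no q  | _     | _     = inj₂ λ _ h → contradiction h q
      ... | yes _ | yes _ | yes p | _     = inj₂ λ _ _ h → contradiction p h
      ... | yes _ | yes _ | no _  | true  = inj₂ λ _ _ _ → refl
      ... | yes s≤x | yes x≤r | no x≢c | false with x ≟ n
      ...   | yes refl = inj₁ (to-n e)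
      ...   | no x≢n   = inj₁ (to-x x s≤x (≤∧≢⇒< x≤r (λ h → x≢n (toℕ-injective h))) x≢c e)
    ... | inj₁ b = inj₁ b
    ... | inj₂ f = inj₂ λ _ _ _ → f

  module _ (F₁ : Later) (F₂ : Earlier F₁) where

    Complete : Set
    Complete = ∀ x y → s ≤ toℕ x → toℕ x < r → s ≤ toℕ y → toℕ y < r → y ≢ x → adj H x y ≡ true

    -- For a missing edge `x y`, replace `x u` by `x y` and `y z` by `z n`, and add `u n`. Only the
    -- degree of `n` changes, by two. Since `u n` and `z n` both have to be new edges, `x` must
    -- offer a neighbour `u` outside the neighbourhood of `n` that differs from `z`.
    complete : Better ⊎ Complete
    complete = scan N λ x → scan N λ y → move x y
      where
      repair : ∀ x y → s ≤ toℕ x → toℕ x < r → s ≤ toℕ y → toℕ y < r → y ≢ x → adj H x y ≡ false → Better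
      repair x y s≤x x<r s≤y y<r y≢x xy = double (set R₂.rotate u n u≢n true) sp degs keeps
        where
        x≢y : x ≢ y
        x≢y e = y≢x (≡-sym e)
        x≢n = <r⇒≢n x<r
        y≢n = <r⇒≢n y<r
        o = outer y y<r
        z = proj₁ o
        yz = proj₁ (proj₂ o)
        z≢n = proj₁ (proj₂ (proj₂ o))
        nz = proj₂ (proj₂ (proj₂ o))
        z≢x : z ≢ x
        z≢x z≡x = true≢false (subst (λ v → adj H y v ≡ true) z≡x yz) (adj-sym H xy)
        -- Inside N[n] the vertex x misses itself and y, so it has at least two neighbours outside N[n].
        second : ∃ λ u → (not (is z u) ∧ adj H x u) ≡ true × (not (is x u) ∧ (not (is y u) ∧ (is n u ∨ adj H n u))) ≡ false
        second = count-<⇒∖ (λ u → not (is z u) ∧ adj H x u) inside inside<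
          where
          closed : Fin N → Bool
          closed u = is n u ∨ adj H n u
          inside : Fin N → Bool
          inside u = not (is x u) ∧ (not (is y u) ∧ closed u)
          closed-count : count closed ≡ suc (deg H n)
          closed-count = trans (count-+ closed (is n) (adj H n) pointwise) (cong (_+ deg H n) (count-is n))
            where
            pointwise : ∀ u → 𝟙 (closed u) ≡ 𝟙 (is n u) + 𝟙 (adj H n u)
            pointwise u with u ≟ n
            ... | yes refl rewrite irrefl H u = refl
            ... | no _     = refl
          closed-x : (not (is y x) ∧ closed x) ≡ true
          closed-x rewrite is-≢ {i = y} {x} x≢y | adj-sym H (F₂ x s≤x x<r) = Bool.∨-zeroʳ (is n x)
          closed-y : closed y ≡ true
          closed-y rewrite adj-sym H (F₂ y s≤y y<r) = Bool.∨-zeroʳ (is n y)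
          inside-count : suc (count inside) ≡ deg H n
          inside-count = suc-injective (begin
            suc (suc (count inside))
              ≡⟨ cong (λ v → suc (𝟙 v + count inside)) closed-x ⟨
            suc (𝟙 (not (is y x) ∧ closed x) + count inside)
              ≡⟨ cong suc (count-remove (λ u → not (is y u) ∧ closed u) x) ⟨
            suc (count (λ u → not (is y u) ∧ closed u))
              ≡⟨ cong (λ v → 𝟙 v + count (λ u → not (is y u) ∧ closed u)) closed-y ⟨
            𝟙 (closed y) + count (λ u → not (is y u) ∧ closed u)
              ≡⟨ count-remove closed y ⟨
            count closed
              ≡⟨ closed-count ⟩
            suc (deg H n) ∎)
            where open ≡-Reasoning
          𝟙≤1 : ∀ b → 𝟙 b ≤ 1
          𝟙≤1 true  = ≤-refl
          𝟙≤1 false = z≤n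
          inside< : count inside < count (λ u → not (is z u) ∧ adj H x u)
          inside< = ≤-pred (begin
            suc (suc (count inside))   ≡⟨ cong suc inside-count ⟩
            suc (deg H n)              ≤⟨ deficient ⟩
            π n                        ≤⟨ mono x n (<⇒≤ x<r) ⟩
            π x                        ≡⟨ sat x x<r ⟨
            deg H x                    ≡⟨ count-remove (adj H x) z ⟩
            𝟙 (adj H x z) + count (λ u → not (is z u) ∧ adj H x u)
                                       ≤⟨ +-monoˡ-≤ _ (𝟙≤1 (adj H x z)) ⟩
            suc (count (λ u → not (is z u) ∧ adj H x u)) ∎)
            where open ≤-Reasoning
        u = proj₁ second
        xu : adj H x u ≡ true
        xu = proj₂ (∧⇒ {not (is z u)} (proj₁ (proj₂ second)))
        u≢z : u ≢ z
        u≢z = does⇏ (u ≟ z) (not⇒ (proj₁ (∧⇒ {not (is z u)} (proj₁ (proj₂ second)))))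
        u≢x : u ≢ x
        u≢x e = adj-≢ H xu (≡-sym e)
        u≢y : u ≢ y
        u≢y u≡y = true≢false (subst (λ v → adj H x v ≡ true) u≡y xu) xy
        outside : (is n u ∨ adj H n u) ≡ false
        outside = trans (cong₂ (λ a b → not a ∧ (not b ∧ (is n u ∨ adj H n u))) (≡-sym (is-≢ u≢x)) (≡-sym (is-≢ u≢y)))
                        (proj₂ (proj₂ second))
        nu : adj H n u ≡ false
        nu = ≢true (λ e → true≢false (trans (cong (is n u ∨_) e) (Bool.∨-zeroʳ (is n u))) outside)
        u≢n : u ≢ n
        u≢n u≡n = true≢false (trans (cong (_∨ adj H n u) (trans (cong (is n) u≡n) (is-refl n))) refl) outside
        module R₁ = Rotate H {x} {u} {y} x≢y xu xy
        zy₁ : adj R₁.rotate z y ≡ true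
        zy₁ = trans (R₁.rotate-away z≢x y≢x) (adj-sym H yz)
        zn₁ : adj R₁.rotate z n ≡ false
        zn₁ = trans (R₁.rotate-away z≢x (λ e → x≢n (≡-sym e))) (adj-sym H nz)
        module R₂ = Rotate R₁.rotate {z} {y} {n} z≢n zy₁ zn₁
        un₂ : adj R₂.rotate u n ≡ false
        un₂ = trans (R₂.rotate-away u≢z (λ e → z≢n (≡-sym e)))
               (trans (R₁.rotate-away u≢x (λ e → x≢n (≡-sym e))) (adj-sym H nu))
        sp : Split s r (set R₂.rotate u n u≢n true)
        sp = split-add R₂.rotate u≢n (inj₂ ≤-refl)
               (split-rotate R₁.rotate z≢n zy₁ zn₁ (inj₂ s≤y) (inj₂ ≤-refl)
                 (split-rotate H x≢y xu xy (inj₁ s≤x) (inj₁ (<⇒≤ x<r)) split))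
        degs : ∀ i → deg (set R₂.rotate u n u≢n true) i ≡ deg H i + (𝟙 (is n i) + 𝟙 (is n i))
        degs i = +-cancelʳ-≡ Y _ _ (begin
          deg (set R₂.rotate u n u≢n true) i + Y   ≡⟨ cong (_+ Y) (deg-add R₂.rotate u≢n un₂ i) ⟩
          D₂ + (U + M) + Y                         ≡⟨ e₁ D₂ U M Y ⟩
          D₂ + Y + (U + M)                         ≡⟨ cong (_+ (U + M)) (R₂.rotate-deg i) ⟩
          D₁ + M + (U + M)                         ≡⟨ e₂ D₁ M U ⟩
          D₁ + U + (M + M)                         ≡⟨ cong (_+ (M + M)) (R₁.rotate-deg i) ⟩
          deg H i + Y + (M + M)                    ≡⟨ e₃ (deg H i) Y M ⟩
          deg H i + (M + M) + Y                    ∎)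
          where
          open ≡-Reasoning
          D₁ = deg R₁.rotate i
          D₂ = deg R₂.rotate i
          U = 𝟙 (is u i)
          M = 𝟙 (is n i)
          Y = 𝟙 (is y i)
          e₁ : ∀ d u m y → d + (u + m) + y ≡ d + y + (u + m)
          e₁ = solve-∀
          e₂ : ∀ d m u → d + m + (u + m) ≡ d + u + (m + m)
          e₂ = solve-∀
          e₃ : ∀ d y m → d + y + (m + m) ≡ d + (m + m) + y
          e₃ = solve-∀
        keeps : ∀ w → r < toℕ w → deg H w < π w → adj (set R₂.rotate u n u≢n true) n w ≡ true
        keeps w r<w lt = set-true R₂.rotate u≢n {n} {w} (trans (R₂.rotate-away (λ e → z≢n (≡-sym e)) w≢z)
          (trans (R₁.rotate-away (λ e → x≢n (≡-sym e)) (λ e → >r⇒≢ r<w x<r (≡-sym e))) (F₁ w r<w lt)))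
          where
          w≢z : w ≢ z
          w≢z e = true≢false (subst (λ v → adj H n v ≡ true) e (F₁ w r<w lt)) nz
      move : ∀ x y → Better ⊎ (s ≤ toℕ x → toℕ x < r → s ≤ toℕ y → toℕ y < r → y ≢ x → adj H x y ≡ true)
      move x y with s ≤? toℕ x | toℕ x <? r | s ≤? toℕ y | toℕ y <? r | y ≟ x | adj H x y in e
      ... | no p  | _     | _     | _     | _     | _    = inj₂ λ h → contradiction h p
      ... | yes _ | no p  | _     | _     | _     | _    = inj₂ λ _ h → contradiction h p
      ... | yes _ | yes _ | no p  | _     | _     | _    = inj₂ λ _ _ h → contradiction h p
      ... | yes _ | yes _ | yes _ | no p  | _     | _    = inj₂ λ _ _ _ h → contradiction h p
      ... | yes _ | yes _ | yes _ | yes _ | yes p | _    = inj₂ λ _ _ _ _ h → contradiction p h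
      ... | yes _ | yes _ | yes _ | yes _ | no _  | true = inj₂ λ _ _ _ _ _ → refl
      ... | yes a | yes b | yes c | yes d | no f  | false = inj₁ (repair x y a b c d f e)

  Reaching : Set
  Reaching = ∀ c → toℕ c < s → ∃ λ w → r < toℕ w × adj H c w ≡ true

  Covered : Set
  Covered = ∀ w → r < toℕ w → deg H w < π w → ∀ c → toℕ c < s → adj H c w ≡ true

  -- If `c w` is missing, `attach` applies to `c` and its private neighbour `z`, unless `z` lies in
  -- the clique as well. But then `z` has a neighbour beyond `n`, so `Linked` makes it adjacent to
  -- `n`, against its choice.
  covered : Linked → Reaching → Better ⊎ Covered
  covered F₄ reach = scan N λ w → test w (r <? toℕ w) (deg H w <? π w)
    where
    test : ∀ w → Dec (r < toℕ w) → Dec (deg H w < π w) →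
            Better ⊎ (r < toℕ w → deg H w < π w → ∀ c → toℕ c < s → adj H c w ≡ true)
    test w (no p)    _        = inj₂ λ h → contradiction h p
    test w (yes _)   (no q)   = inj₂ λ _ h → contradiction h q
    test w (yes r<w) (yes lt) with scan N move
      where
      move : ∀ c → Better ⊎ (toℕ c < s → adj H c w ≡ true)
      move c with toℕ c <? s | adj H c w in e
      ... | no p  | _     = inj₂ λ h → contradiction h p
      ... | yes _ | true  = inj₂ λ _ → refl
      ... | yes c<s | false with outer c (<-≤-trans c<s s≤r)
      ...   | z , cz , z≢n , nz with toℕ z <? s
      ...     | no z≮s  = inj₁ (attach (<-≤-trans c<s s≤r) r<w lt e cz z≢n nz (inj₂ (≮⇒≥ z≮s)))
      ...     | yes z<s = let w' , r<w' , zw' = reach z z<s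
                              zn = F₄ z w' (<-≤-trans z<s s≤r) r<w' zw' n s≤r ≤-refl (λ e → z≢n (≡-sym e))
                          in ⊥-elim (true≢false (adj-sym H zn) nz)
    ... | inj₁ b = inj₁ b
    ... | inj₂ f = inj₂ λ _ _ → f

-- Counting edges when no exchange applies

module Stuck {N} (π : Fin N → ℕ) (mono : Nonincreasing π) (G₀ : Graph N) (R₀ : Realization π G₀)
             (s : ℕ) (n : Fin N) (s≤r : s ≤ toℕ n)
             (H : Graph N) (I : Inv π s (toℕ n) H) (deficient : deg H n < π n) where

  open Inv I
  open Moves π mono G₀ R₀ s n s≤r H I deficient

  head tail S Q : Fin N → Bool
  head = below (suc r)
  tail i = not (head i)
  S = below s
  Q = between s (suc r)

  head-⇒ : ∀ {i} → head i ≡ true → toℕ i ≤ r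
  head-⇒ {i} e = ≤-pred (below-⇒ {k = suc r} {i} e)

  head-⇐ : ∀ {i} → toℕ i ≤ r → head i ≡ true
  head-⇐ {i} h = below-⇐ {k = suc r} {i} (s≤s h)

  tail-⇒ : ∀ {i} → tail i ≡ true → r < toℕ i
  tail-⇒ {i} e = below-⇏ {k = suc r} {i} (not⇒ e)

  tail-⇐ : ∀ {i} → r < toℕ i → tail i ≡ true
  tail-⇐ {i} h = cong not (dec-false (toℕ i <? suc r) (≤⇒≯ h))

  S-⇒ : ∀ {i} → S i ≡ true → toℕ i < s
  S-⇒ {i} = below-⇒ {k = s} {i}

  Q-⇒ : ∀ {i} → Q i ≡ true → s ≤ toℕ i × toℕ i ≤ r
  Q-⇒ {i} e = let l , u = between-⇒ i e in l , ≤-pred u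

  nQ : Q n ≡ true
  nQ = between-⇐ n s≤r ≤-refl

  deg-split : ∀ (G : Graph N) i → deg G i ≡ nbrs G head i + nbrs G tail i
  deg-split G i = count-split (adj G i) head

  head-split : ∀ (G : Graph N) i → nbrs G head i ≡ nbrs G S i + nbrs G Q i
  head-split G i = nbrs-split G head S Q i pointwise
    where
    pointwise : ∀ j → 𝟙 (head j) ≡ 𝟙 (S j) + 𝟙 (Q j)
    pointwise j with S j in p
    ... | false = cong 𝟙 (≡-sym (Bool.∧-identityʳ (head j)))
    ... | true rewrite head-⇐ (≤-trans (<⇒≤ (S-⇒ p)) s≤r) = refl

  tail-indep : ∀ w → r < toℕ w → nbrs H tail w ≡ 0
  tail-indep w r<w = nbrs-none H tail w (λ j e → proj₂ split w j r<w (tail-⇒ e))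

  deficit : ∀ p → p n ≡ true → sumOn p (deg H) < sumOn p π
  deficit p pn = sumOn-mono-< p (λ i _ → deg≤ i) n pn deficient

  module Cases (F₁ : Later) (F₂ : Earlier F₁) (F₃ : Attached) (F₄ : Linked) (F₅ : Complete F₁ F₂) where

    Q-clique : ∀ x y → Q x ≡ true → Q y ≡ true → y ≢ x → adj H x y ≡ true
    Q-clique x y qx qy y≢x with x ≟ n | y ≟ n
    ... | yes refl | yes refl = contradiction refl y≢x
    ... | yes refl | no y≢n   = adj-sym H (F₂ y (proj₁ (Q-⇒ qy)) (≤∧≢⇒< (proj₂ (Q-⇒ qy)) (λ e → y≢n (toℕ-injective e))))
    ... | no x≢n   | yes refl = F₂ x (proj₁ (Q-⇒ qx)) (≤∧≢⇒< (proj₂ (Q-⇒ qx)) (λ e → x≢n (toℕ-injective e)))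
    ... | no x≢n   | no y≢n   = F₅ x y (proj₁ (Q-⇒ qx)) (≤∧≢⇒< (proj₂ (Q-⇒ qx)) (λ e → x≢n (toℕ-injective e)))
                                   (proj₁ (Q-⇒ qy)) (≤∧≢⇒< (proj₂ (Q-⇒ qy)) (λ e → y≢n (toℕ-injective e))) y≢x

    Q-unsat : ∀ w → r < toℕ w → deg H w < π w → ∀ x → Q x ≡ true → adj H w x ≡ true
    Q-unsat w r<w lt x qx with x ≟ n
    ... | yes refl = adj-sym H (F₁ w r<w lt)
    ... | no x≢n   = adj-sym H (F₃ w r<w lt x (proj₁ (Q-⇒ qx)) (≤∧≢⇒< (proj₂ (Q-⇒ qx)) (λ e → x≢n (toℕ-injective e))))

    -- Here the vertices up to n form a clique of H with at least as many edges to the rest as in G₀,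
    -- so their degree sum in H is not smaller than in G₀.
    module AllReach (reach : Reaching) (F₆ : Covered) where

      head-cases : ∀ i → head i ≡ true → toℕ i < s ⊎ Q i ≡ true
      head-cases i e with toℕ i <? s
      ... | yes p = inj₁ p
      ... | no p  = inj₂ (between-⇐ i (≮⇒≥ p) (s≤s (head-⇒ e)))

      SQ : ∀ c x → toℕ c < s → Q x ≡ true → adj H c x ≡ true
      SQ c x c<s qx = let w , r<w , cw = reach c c<s
                          s≤x , x≤r = Q-⇒ qx
                      in F₄ c w (<-≤-trans c<s s≤r) r<w cw x s≤x x≤r (λ { refl → <⇒≱ c<s s≤x })

      head-clique : ∀ i j → head i ≡ true → head j ≡ true → j ≢ i → adj H i j ≡ true
      head-clique i j hi hj j≢i with head-cases i hi | head-cases j hj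
      ... | inj₁ p | inj₁ q = proj₁ split i j p q (λ e → j≢i (≡-sym e))
      ... | inj₁ p | inj₂ q = SQ i j p q
      ... | inj₂ p | inj₁ q = adj-sym H (SQ j i q p)
      ... | inj₂ p | inj₂ q = Q-clique i j p q j≢i

      head-full : ∀ w → r < toℕ w → deg H w < π w → ∀ j → head j ≡ true → adj H w j ≡ true
      head-full w r<w lt j hj with head-cases j hj
      ... | inj₁ p = adj-sym H (F₆ w r<w lt j p)
      ... | inj₂ q = Q-unsat w r<w lt j q

      compare-head : ∀ i → head i ≡ true → nbrs G₀ head i ≤ nbrs H head i
      compare-head i hi = ≤-pred (≤-trans (nbrs-< G₀ head i hi)
        (≤-reflexive (≡-sym (nbrs-clique H head i hi (λ j hj → head-clique i j hi hj)))))

      -- A deficient `w` is joined to everything up to `n`. A saturated `w` sends all its edges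
      -- there, because the vertices after `n` are independent.
      compare-tail : ∀ w → tail w ≡ true → nbrs G₀ head w ≤ nbrs H head w
      compare-tail w tw with deg H w <? π w
      ... | yes lt = ≤-trans (nbrs-≤count G₀ head w)
                       (≤-reflexive (≡-sym (nbrs-full H head w (head-full w (tail-⇒ tw) lt))))
      ... | no ¬lt = begin
        nbrs G₀ head w                  ≤⟨ nbrs-≤deg G₀ head w ⟩
        deg G₀ w                        ≡⟨ R₀ w ⟩
        π w                             ≤⟨ ≮⇒≥ ¬lt ⟩
        deg H w                         ≡⟨ deg-split H w ⟩
        nbrs H head w + nbrs H tail w   ≡⟨ cong (nbrs H head w +_) (tail-indep w (tail-⇒ tw)) ⟩
        nbrs H head w + 0               ≡⟨ +-identityʳ _ ⟩
        nbrs H head w                   ∎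
        where open ≤-Reasoning

      absurd : ⊥
      absurd = <⇒≱ (deficit head (head-⇐ ≤-refl)) (begin
        sumOn head π                                          ≡⟨ sumOn-cong head (λ i _ → R₀ i) ⟨
        sumOn head (deg G₀)                                   ≡⟨ expand G₀ ⟩
        sumOn head (nbrs G₀ head) + sumOn tail (nbrs G₀ head) ≤⟨ +-mono-≤ (sumOn-mono head compare-head) (sumOn-mono tail compare-tail) ⟩
        sumOn head (nbrs H head) + sumOn tail (nbrs H head)   ≡⟨ expand H ⟨
        sumOn head (deg H)                                    ∎)
        where
        open ≤-Reasoning
        expand : ∀ G → sumOn head (deg G) ≡ sumOn head (nbrs G head) + sumOn tail (nbrs G head)
        expand G = trans (sumOn-cong head (λ i _ → deg-split G i))
          (trans (sumOn-+ head (nbrs G head) (nbrs G tail)) (cong (sumOn head (nbrs G head) +_) (double-count G head tail)))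

    -- The remaining case: the clique vertex `c₀` has no neighbour beyond `n`. The role of `D` will
    -- be played by the degree at index `s`, which separates the degrees in the clique from all
    -- others; `ε` is its excess over s - 1.
    module SomeClosed (c₀ : Fin N) (c₀<s : toℕ c₀ < s) (closed₀ : ∀ w → r < toℕ w → adj H c₀ w ≡ false)
                      (D : ℕ) (D-head : ∀ c → toℕ c < s → D ≤ π c) (D-tail : ∀ x → s ≤ toℕ x → π x ≤ D)
                      (ε : ℕ) (Dε : suc D ≡ s + ε) where

      open-end? : ∀ c → Dec (∃ λ w → r < toℕ w × adj H c w ≡ true)
      open-end? c = any? (λ w → (r <? toℕ w) ×-dec (adj H c w Bool.≟ true))

      -- `J` collects the clique vertices with a neighbour beyond `n`, which `Linked` joins to the
      -- whole of `Q`; `R` collects the others, such as `c₀`.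
      J R : Fin N → Bool
      J c = S c ∧ does (open-end? c)
      R c = S c ∧ not (does (open-end? c))

      S-split : ∀ c → 𝟙 (S c) ≡ 𝟙 (J c) + 𝟙 (R c)
      S-split c with S c | does (open-end? c)
      ... | false | _     = refl
      ... | true  | true  = refl
      ... | true  | false = refl

      q p ρ : ℕ
      q = count Q
      p = count J
      ρ = count R

      s≤N : s ≤ N
      s≤N = ≤-trans s≤r (<⇒≤ (toℕ<n n))

      s≡p+ρ : s ≡ p + ρ
      s≡p+ρ = trans (≡-sym (count-below N s s≤N)) (count-+ S J R S-split)

      s+q : s + q ≡ suc r
      s+q = count-between N s (suc r) (m≤n⇒m≤1+n s≤r) (toℕ<n n)

      QJ : ∀ x → Q x ≡ true → ∀ c → J c ≡ true → adj H x c ≡ true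
      QJ x qx c kc =
        let sc , oc = ∧⇒ {S c} kc
            w , r<w , cw = does⇒ (open-end? c) oc
            s≤x , x≤r = Q-⇒ qx
            c<s = S-⇒ sc
        in adj-sym H (F₄ c w (<-≤-trans c<s s≤r) r<w cw x s≤x x≤r (λ { refl → <⇒≱ c<s s≤x }))

      R-closed : ∀ c → R c ≡ true → toℕ c < s × (∀ w → r < toℕ w → adj H c w ≡ false)
      R-closed c rc =
        let sc , oc = ∧⇒ {S c} rc
        in S-⇒ sc , λ w r<w → ≢true (λ cw → does⇏ (open-end? c) (not⇒ oc) (w , r<w , cw))

      -- All edges of such a `c` go to the clique or to `Q`. As its degree is at least `D`, at least
      -- `ε` of them must end in `Q`.
      closed-degree : ∀ c → toℕ c < s → (∀ w → r < toℕ w → adj H c w ≡ false) → suc (π c) ≡ s + nbrs H Q c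
      closed-degree c c<s cl = begin
        suc (π c)                                    ≡⟨ cong suc (sat c (<-≤-trans c<s s≤r)) ⟨
        suc (deg H c)                                ≡⟨ cong suc (deg-split H c) ⟩
        suc (nbrs H head c + nbrs H tail c)          ≡⟨ cong₂ (λ u v → suc (u + v)) (head-split H c) (nbrs-none H tail c (λ j e → cl j (tail-⇒ e))) ⟩
        suc (nbrs H S c + nbrs H Q c + 0)            ≡⟨ cong suc (+-identityʳ _) ⟩
        suc (nbrs H S c) + nbrs H Q c                ≡⟨ cong (_+ nbrs H Q c) (nbrs-clique H S c (below-⇐ {k = s} {c} c<s)
                                                          (λ j e j≢c → proj₁ split c j c<s (S-⇒ e) (λ e' → j≢c (≡-sym e')))) ⟩
        count S + nbrs H Q c                         ≡⟨ cong (_+ nbrs H Q c) (count-below N s s≤N) ⟩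
        s + nbrs H Q c                               ∎
        where open ≡-Reasoning

      ε≤nbrs : ∀ c → toℕ c < s → (∀ w → r < toℕ w → adj H c w ≡ false) → ε ≤ nbrs H Q c
      ε≤nbrs c c<s cl = +-cancelˡ-≤ s _ _ (subst₂ _≤_ Dε (closed-degree c c<s cl) (s≤s (D-head c c<s)))

      ε≤q : ε ≤ q
      ε≤q = ≤-trans (ε≤nbrs c₀ c₀<s closed₀) (nbrs-≤count H Q c₀)

      E : ℕ
      E = sumOn tail (nbrs H Q)

      Q-degree : ∀ x → Q x ≡ true → suc (deg H x) ≡ (q + p) + (nbrs H R x + nbrs H tail x)
      Q-degree x qx = begin
        suc (deg H x)                                            ≡⟨ cong suc (deg-split H x) ⟩
        suc (nbrs H head x + nbrs H tail x)                      ≡⟨ cong (λ v → suc (v + nbrs H tail x)) (head-split H x) ⟩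
        suc (nbrs H S x + nbrs H Q x + nbrs H tail x)            ≡⟨ cong (λ v → suc (v + nbrs H Q x + nbrs H tail x)) (nbrs-split H S J R x S-split) ⟩
        suc (nbrs H J x + nbrs H R x + nbrs H Q x + nbrs H tail x) ≡⟨ arith (nbrs H J x) (nbrs H R x) (nbrs H Q x) (nbrs H tail x) ⟩
        suc (nbrs H Q x) + nbrs H J x + (nbrs H R x + nbrs H tail x)
          ≡⟨ cong₂ (λ u v → u + v + (nbrs H R x + nbrs H tail x))
               (nbrs-clique H Q x qx (λ y qy → Q-clique x y qx qy)) (nbrs-full H J x (QJ x qx)) ⟩
        (q + p) + (nbrs H R x + nbrs H tail x)                   ∎
        where
        open ≡-Reasoning
        arith : ∀ k r q t → suc (k + r + q + t) ≡ suc q + k + (r + t)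
        arith = solve-∀

      -- Double counting of the edges at Q, using s = p + ρ and D = s − 1 + ε.
      main : suc (q * q + ρ * ε + E) ≤ q * ρ + q * ε
      main = farkas 0 total (trans (cong (λ v → suc (q * q + ρ * ε + E) + q * (v + ε) + 0) s≡p+ρ) (arith q p ρ ε E))
        where
        arith : ∀ q p ρ ε E → suc (q * q + ρ * ε + E) + q * ((p + ρ) + ε) + 0 ≡ q * ρ + q * ε + suc (q * (q + p) + (ρ * ε + E))
        arith = solve-∀
        upper : suc (sumOn Q (suc ∘ deg H)) ≤ q * (s + ε)
        upper = begin
          suc (sumOn Q (suc ∘ deg H))           ≡⟨ cong suc (trans (sumOn-+ Q (λ _ → 1) (deg H)) (cong (_+ sumOn Q (deg H)) (sumOn-const Q 1))) ⟩
          suc (q * 1 + sumOn Q (deg H))         ≡⟨ +-suc (q * 1) (sumOn Q (deg H)) ⟨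
          q * 1 + suc (sumOn Q (deg H))         ≤⟨ +-monoʳ-≤ (q * 1) (deficit Q nQ) ⟩
          q * 1 + sumOn Q π                     ≤⟨ +-monoʳ-≤ (q * 1) (sumOn-mono Q (λ x qx → D-tail x (proj₁ (Q-⇒ qx)))) ⟩
          q * 1 + sumOn Q (λ _ → D)             ≡⟨ cong (q * 1 +_) (sumOn-const Q D) ⟩
          q * 1 + q * D                         ≡⟨ *-distribˡ-+ q 1 D ⟨
          q * suc D                             ≡⟨ cong (q *_) Dε ⟩
          q * (s + ε)                           ∎
          where open ≤-Reasoning
        lower : q * (q + p) + (ρ * ε + E) ≤ sumOn Q (suc ∘ deg H)
        lower = begin
          q * (q + p) + (ρ * ε + E)
            ≡⟨ cong₂ (λ u v → u + (v + E)) (sumOn-const Q (q + p)) (sumOn-const R ε) ⟨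
          sumOn Q (λ _ → q + p) + (sumOn R (λ _ → ε) + E)
            ≤⟨ +-monoʳ-≤ (sumOn Q (λ _ → q + p)) (+-monoˡ-≤ E (sumOn-mono R (λ c rc → ε≤nbrs c (proj₁ (R-closed c rc)) (proj₂ (R-closed c rc))))) ⟩
          sumOn Q (λ _ → q + p) + (sumOn R (nbrs H Q) + E)
            ≡⟨ cong₂ (λ u v → sumOn Q (λ _ → q + p) + (u + v)) (double-count H R Q) (double-count H tail Q) ⟩
          sumOn Q (λ _ → q + p) + (sumOn Q (nbrs H R) + sumOn Q (nbrs H tail))
            ≡⟨ cong (sumOn Q (λ _ → q + p) +_) (sumOn-+ Q (nbrs H R) (nbrs H tail)) ⟨
          sumOn Q (λ _ → q + p) + sumOn Q (λ x → nbrs H R x + nbrs H tail x)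
            ≡⟨ sumOn-+ Q (λ _ → q + p) (λ x → nbrs H R x + nbrs H tail x) ⟨
          sumOn Q (λ x → (q + p) + (nbrs H R x + nbrs H tail x))
            ≡⟨ sumOn-cong Q Q-degree ⟨
          sumOn Q (suc ∘ deg H) ∎
          where open ≤-Reasoning
        total : suc (q * (q + p) + (ρ * ε + E)) ≤ q * (s + ε)
        total = ≤-trans (s≤s lower) upper

      -- Over the integers `main` reads (q - ρ)(q - ε) + E < 0, and q - ε is nonnegative by `ε≤q`;
      -- so q - ρ is negative. In natural numbers this is a call of `farkas`: the added hypotheses
      -- and a ring identity with slack `E` yield 1 ≤ 0.
      q<ρ : q < ρ
      q<ρ with q <? ρ
      ... | yes lt = lt
      ... | no ¬lt = contradiction (farkas {p = 1} {q = 0} E combined eq) λ ()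
        where
        a = proj₁ (m≤n⇒∃[o]m+o≡n (≮⇒≥ ¬lt))
        ρ+a : ρ + a ≡ q
        ρ+a = proj₂ (m≤n⇒∃[o]m+o≡n (≮⇒≥ ¬lt))
        combined : suc (q * q + ρ * ε + E) + a * ε ≤ q * ρ + q * ε + a * q
        combined = +-mono-≤ main (*-monoʳ-≤ a ε≤q)
        arith : ∀ ρ a ε E → suc (0) + ((ρ + a) * ρ + (ρ + a) * ε + a * (ρ + a)) + E ≡
                0 + (suc ((ρ + a) * (ρ + a) + ρ * ε + E) + a * ε)
        arith = solve-∀
        eq : 1 + (q * ρ + q * ε + a * q) + E ≡ 0 + (suc (q * q + ρ * ε + E) + a * ε)
        eq = subst (λ v → 1 + (v * ρ + v * ε + a * v) + E ≡ 0 + (suc (v * v + ρ * ε + E) + a * ε)) ρ+a (arith ρ a ε E)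

      ρ≤s : ρ ≤ s
      ρ≤s = subst (ρ ≤_) (≡-sym s≡p+ρ) (m≤n+m ρ p)

      -- After `n`, s - q of the first 2s vertices remain. Each has at least q neighbours in `Q`: a
      -- deficient one is joined to all of `Q`; a saturated one has at least s - 1 edges, all into
      -- `J` or `Q`, hence at least ρ - 1 ≥ q into `Q`. So E ≥ q(s - q) ≥ q(ρ - q) ≥ (ρ - q)(q - ε),
      -- against `main`.
      many-absurd : s + s ≤ N → (∀ i → toℕ i < s + s → s ≤ suc (π i)) → ⊥
      many-absurd 2s≤N big = n≮0 (farkas {p = 1} {q = 0} 0 combined (arith q ρ ε E V))
        where
        M : Fin N → Bool
        M = between (suc r) (s + s)
        V = count M
        sr≤2s : suc r ≤ s + s
        sr≤2s = subst (_≤ s + s) s+q (+-monoʳ-≤ s (<⇒≤ (<-≤-trans q<ρ ρ≤s)))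
        q+V : q + V ≡ s
        q+V = +-cancelˡ-≡ s _ _ (begin
          s + (q + V)   ≡⟨ +-assoc s q V ⟨
          s + q + V     ≡⟨ cong (_+ V) s+q ⟩
          suc r + V     ≡⟨ count-between N (suc r) (s + s) sr≤2s 2s≤N ⟩
          s + s         ∎)
          where open ≡-Reasoning
        M-tail : ∀ w → M w ≡ true → r < toℕ w
        M-tail w mw = proj₁ (between-⇒ {l = suc r} {s + s} w mw)
        each : ∀ w → M w ≡ true → q ≤ nbrs H Q w
        each w mw with deg H w <? π w
        ... | yes lt = ≤-reflexive (≡-sym (nbrs-full H Q w (Q-unsat w (M-tail w mw) lt)))
        ... | no ¬lt = +-cancelˡ-≤ (suc p) _ _ (begin
          suc p + q                             ≡⟨ +-suc p q ⟨
          p + suc q                             ≤⟨ +-monoʳ-≤ p q<ρ ⟩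
          p + ρ                                 ≡⟨ s≡p+ρ ⟨
          s                                     ≤⟨ big w (proj₂ (between-⇒ {l = suc r} {s + s} w mw)) ⟩
          suc (π w)                             ≤⟨ s≤s (≮⇒≥ ¬lt) ⟩
          suc (deg H w)                         ≡⟨ cong suc (deg-split H w) ⟩
          suc (nbrs H head w + nbrs H tail w)   ≡⟨ cong₂ (λ u v → suc (u + v)) (head-split H w) (tail-indep w (M-tail w mw)) ⟩
          suc (nbrs H S w + nbrs H Q w + 0)     ≡⟨ cong suc (+-identityʳ _) ⟩
          suc (nbrs H S w + nbrs H Q w)         ≡⟨ cong (λ v → suc (v + nbrs H Q w)) (nbrs-split H S J R w S-split) ⟩
          suc (nbrs H J w + nbrs H R w + nbrs H Q w)
            ≡⟨ cong (λ v → suc (nbrs H J w + v + nbrs H Q w)) (nbrs-none H R w (λ c rc → adj-sym H (proj₂ (R-closed c rc) w (M-tail w mw)))) ⟩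
          suc (nbrs H J w + 0 + nbrs H Q w)     ≡⟨ cong (λ v → suc (v + nbrs H Q w)) (+-identityʳ _) ⟩
          suc (nbrs H J w + nbrs H Q w)         ≤⟨ s≤s (+-monoˡ-≤ (nbrs H Q w) (nbrs-≤count H J w)) ⟩
          suc p + nbrs H Q w                    ∎)
          where open ≤-Reasoning
        VqE : V * q ≤ E
        VqE = begin
          V * q              ≡⟨ sumOn-const M q ⟨
          sumOn M (λ _ → q)  ≤⟨ sumOn-mono M each ⟩
          sumOn M (nbrs H Q) ≤⟨ sum-mono-≤ widen ⟩
          E                  ∎
          where
          open ≤-Reasoning
          widen : ∀ w → (if M w then nbrs H Q w else 0) ≤ (if tail w then nbrs H Q w else 0)
          widen w with M w in mw
          ... | false = z≤n
          ... | true rewrite tail-⇐ (M-tail w mw) = ≤-refl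
        combined : suc (q * q + ρ * ε + E) + V * q + q * ρ + q * ε ≤ q * ρ + q * ε + E + q * (q + V) + ρ * ε
        combined = +-mono-≤ (+-mono-≤ (+-mono-≤ main VqE) (*-monoʳ-≤ q (subst (ρ ≤_) (≡-sym q+V) ρ≤s)))
                            (*-monoˡ-≤ ε (<⇒≤ q<ρ))
        arith : ∀ q ρ ε E V → suc 0 + (q * ρ + q * ε + E + q * (q + V) + ρ * ε) + 0 ≡
                0 + (suc (q * q + ρ * ε + E) + V * q + q * ρ + q * ε)
        arith = solve-∀

      -- Now s ≤ 1 + ε, so ε ≤ q < ρ ≤ s leaves only q = ε. The product in `main` then vanishes, and
      -- E would be negative.
      large-absurd : s + s ≤ suc (suc D) → ⊥
      large-absurd large = n≮0 (farkas {p = 1} {q = 0} E main (subst (λ v → 1 + (q * ρ + q * v) + E ≡ 0 + suc (q * q + ρ * v + E)) q≡ε (arith q ρ E)))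
        where
        arith : ∀ q ρ E → 1 + (q * ρ + q * q) + E ≡ 0 + suc (q * q + ρ * q + E)
        arith = solve-∀
        s≤1+ε : s ≤ suc ε
        s≤1+ε = +-cancelˡ-≤ s _ _ (≤-trans large (≤-reflexive (trans (cong suc Dε) (≡-sym (+-suc s ε)))))
        q≡ε : q ≡ ε
        q≡ε = ≤-antisym (≤-pred (≤-trans (<-≤-trans q<ρ ρ≤s) s≤1+ε)) ε≤q

-- In the 1-based notation of degree sequences: d_{2s} ≥ s − 1, or d_{s+1} ≥ 2s − 2.
ManyOrLarge : ∀ {N} → (Fin N → ℕ) → ℕ → Set
ManyOrLarge {N} π s = (s + s ≤ N × (∀ i → toℕ i < s + s → s ≤ suc (π i)))
                    ⊎ (∀ i → toℕ i ≡ s → s + s ≤ suc (suc (π i)))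

-- Saturating the vertices one after another

module Filling {N} (π : Fin N → ℕ) (mono : Nonincreasing π) (G₀ : Graph N) (R₀ : Realization π G₀)
               (s : ℕ) (0<s : 0 < s) (ml : ManyOrLarge π s) where

  -- Under either alternative the degree at index `s` is at least s - 1, so that its excess `ε` is a
  -- natural number.
  threshold : ∀ e → toℕ e ≡ s → ManyOrLarge π s → s ≤ suc (π e)
  threshold e toℕ-e (inj₁ (_ , big)) = big e (subst (_< s + s) (≡-sym toℕ-e) (m<n+m s 0<s))
  threshold e toℕ-e (inj₂ large)     = ≤-pred (≤-trans (+-monoˡ-≤ s 0<s) (large e toℕ-e))

  improve : ∀ n → s ≤ toℕ n → ∀ H → Inv π s (toℕ n) H → deg H n < π n →
            ∃ λ H' → Inv π s (toℕ n) H' × deg H n < deg H' n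
  improve n s≤r H I deficient with Moves.later π mono G₀ R₀ s n s≤r H I deficient
  ... | inj₁ b = b
  ... | inj₂ F₁ with Moves.earlier π mono G₀ R₀ s n s≤r H I deficient F₁
                   | Moves.attached π mono G₀ R₀ s n s≤r H I deficient
                   | Moves.linked π mono G₀ R₀ s n s≤r H I deficient
  ...   | inj₁ b  | _       | _       = b
  ...   | inj₂ _  | inj₁ b  | _       = b
  ...   | inj₂ _  | inj₂ _  | inj₁ b  = b
  ...   | inj₂ F₂ | inj₂ F₃ | inj₂ F₄ with Moves.complete π mono G₀ R₀ s n s≤r H I deficient F₁ F₂
  ...     | inj₁ b  = b
  ...     | inj₂ F₅ with any? (λ c → (toℕ c <? s) ×-dec ¬? (any? (λ w → (toℕ n <? toℕ w) ×-dec (adj H c w Bool.≟ true))))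
  ...       | no ¬closed = all-reach
    where
    reach : Moves.Reaching π mono G₀ R₀ s n s≤r H I deficient
    reach c c<s = decidable-stable (any? (λ w → (toℕ n <? toℕ w) ×-dec (adj H c w Bool.≟ true))) (λ ¬w → ¬closed (c , c<s , ¬w))
    all-reach : Moves.Better π mono G₀ R₀ s n s≤r H I deficient
    all-reach with Moves.covered π mono G₀ R₀ s n s≤r H I deficient F₄ reach
    ... | inj₁ b  = b
    ... | inj₂ F₆ = ⊥-elim (Stuck.Cases.AllReach.absurd π mono G₀ R₀ s n s≤r H I deficient F₁ F₂ F₃ F₄ F₅ reach F₆)
  ...       | yes (c₀ , c₀<s , ¬w) = ⊥-elim ([ (λ (h , big) → many-absurd h big) , (λ h → large-absurd (h e toℕ-e)) ] ml)
    where
    s<N : s < N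
    s<N = ≤-<-trans s≤r (toℕ<n n)
    e : Fin N
    e = fromℕ< s<N
    toℕ-e : toℕ e ≡ s
    toℕ-e = toℕ-fromℕ< s<N
    s≤1+D : s ≤ suc (π e)
    s≤1+D = threshold e toℕ-e ml
    excess = m≤n⇒∃[o]m+o≡n s≤1+D
    open Stuck.Cases.SomeClosed π mono G₀ R₀ s n s≤r H I deficient F₁ F₂ F₃ F₄ F₅ c₀ c₀<s
      (λ w r<w → ≢true (λ cw → ¬w (w , r<w , cw)))
      (π e) (λ c c<s → mono c e (<⇒≤ (subst (toℕ c <_) (≡-sym toℕ-e) c<s)))
      (λ x s≤x → mono e x (subst (_≤ toℕ x) (≡-sym toℕ-e) s≤x))
      (proj₁ excess) (≡-sym (proj₂ excess))

  fill : ∀ n → s ≤ toℕ n → ∀ fuel H → Inv π s (toℕ n) H → π n ≤ deg H n + fuel →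
         ∃ λ H' → Inv π s (toℕ n) H' × π n ≤ deg H' n
  fill n s≤r zero       H I le = H , I , subst (π n ≤_) (+-identityʳ _) le
  fill n s≤r (suc fuel) H I le with deg H n <? π n
  ... | no ¬lt = H , I , ≮⇒≥ ¬lt
  ... | yes lt =
    let H' , I' , more = improve n s≤r H I lt
    in fill n s≤r fuel H' I' (≤-trans le (≤-trans (≤-reflexive (+-suc _ fuel)) (+-monoˡ-≤ fuel more)))

  advance : ∀ n → s ≤ toℕ n → ∀ H → Inv π s (toℕ n) H → ∃ λ H' → Inv π s (suc (toℕ n)) H'
  advance n s≤r H I =
    let H' , inv (clique , indep) deg≤ sat , ge = fill n s≤r (π n) H I (m≤n+m (π n) _)
        sat' : ∀ i → toℕ i < suc (toℕ n) → deg H' i ≡ π i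
        sat' i i≤r = [ sat i , (λ e → subst (λ v → deg H' v ≡ π v) (≡-sym (toℕ-injective e)) (≤-antisym (deg≤ n) ge)) ]
                       (m≤n⇒m<n∨m≡n (≤-pred i≤r))
    in H' , inv (clique , λ i j p q → indep i j (<-trans (n<1+n _) p) (<-trans (n<1+n _) q)) deg≤ sat'

  run : ∀ k r → r + k ≡ N → s ≤ r → ∀ H → Inv π s r H → ∃ λ H' → Inv π s N H'
  run zero    r eq s≤r H I = H , subst (λ v → Inv π s v H) (trans (≡-sym (+-identityʳ r)) eq) I
  run (suc k) r eq s≤r H I =
    let r<N = subst (r <_) eq (m<m+n r (s≤s z≤n))
        n = fromℕ< r<N
        toℕ-n = toℕ-fromℕ< r<N
        H' , I' = advance n (subst (s ≤_) (≡-sym toℕ-n) s≤r) H (subst (λ v → Inv π s v H) (≡-sym toℕ-n) I)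
    in run k (suc r) (trans (≡-sym (+-suc r k)) eq) (m≤n⇒m≤1+n s≤r) H' (subst (λ v → Inv π s (suc v) H') toℕ-n I')

-- The starting graph

shrink : ∀ {n} (p : Fin n → Bool) k → k ≤ count p → ∃ λ (q : Fin n → Bool) → (∀ i → q i ≡ true → p i ≡ true) × count q ≡ k
shrink {n}     p zero    _  = (λ _ → false) , (λ _ ()) , count-none {n} _ (λ _ → refl)
shrink {suc n} p (suc k) le with p zero in pz
... | true =
  let q , sub , eq = shrink (p ∘ suc) k (≤-pred le)
  in (λ { zero → true ; (suc i) → q i }) , (λ { zero _ → pz ; (suc i) → sub i }) , cong suc eq
... | false =
  let q , sub , eq = shrink (p ∘ suc) (suc k) le
  in (λ { zero → false ; (suc i) → q i }) , (λ { (suc i) → sub i }) , eq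

-- Each of the first `s` vertices is joined to the others among them and reaches its degree with
-- some of its `G₀`-neighbours outside. There are enough of these, as at most s - 1 of its
-- `G₀`-neighbours lie inside. An outside vertex has only edges of `G₀`, hence not too many, and
-- none to another outside vertex.
module Start {N} (π : Fin N → ℕ) (G₀ : Graph N) (R₀ : Realization π G₀)
             (s : ℕ) (s≤N : s ≤ N) (big : ∀ i → toℕ i < s → s ≤ suc (π i)) where

  private
    S far : Fin N → Bool
    S = below s
    far i = not (S i)

    choice : ∀ u → ∃ λ (q : Fin N → Bool) → (∀ i → q i ≡ true → (far i ∧ adj G₀ u i) ≡ true) ×
                                            (S u ≡ true → s + count q ≡ suc (π u))
    choice u with S u in su
    ... | false = (λ _ → false) , (λ _ ()) , λ ()
    ... | true =
      let k , sk = m≤n⇒∃[o]m+o≡n (big u (below-⇒ {k = s} {u} su))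
          enough : k ≤ nbrs G₀ far u
          enough = +-cancelˡ-≤ s _ _ (begin
            s + k                                  ≡⟨ sk ⟩
            suc (π u)                              ≡⟨ cong suc (R₀ u) ⟨
            suc (deg G₀ u)                         ≡⟨ cong suc (count-split (adj G₀ u) S) ⟩
            suc (nbrs G₀ S u) + nbrs G₀ far u      ≤⟨ +-monoˡ-≤ (nbrs G₀ far u) (nbrs-< G₀ S u su) ⟩
            count S + nbrs G₀ far u                ≡⟨ cong (_+ nbrs G₀ far u) (count-below N s s≤N) ⟩
            s + nbrs G₀ far u                      ∎)
          q , sub , eq = shrink (λ i → far i ∧ adj G₀ u i) k enough
      in q , sub , λ _ → trans (cong (s +_) eq) sk
      where open ≤-Reasoning

    chosen : Fin N → Fin N → Bool
    chosen u = proj₁ (choice u)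

    chosen-far : ∀ u x → chosen u x ≡ true → S x ≡ false × adj G₀ u x ≡ true
    chosen-far u x e = let f , a = ∧⇒ {far x} (proj₁ (proj₂ (choice u)) x e) in not⇒ f , a

    edge : Bool → Bool → Fin N → Fin N → Bool
    edge true  true  i j = not (is i j)
    edge true  false i j = chosen i j
    edge false true  i j = chosen j i
    edge false false i j = false

    edge-sym : ∀ a b i j → edge a b i j ≡ edge b a j i
    edge-sym true  true  i j = cong not (is-comm i j)
    edge-sym true  false i j = refl
    edge-sym false true  i j = refl
    edge-sym false false i j = refl

    edge-irrefl : ∀ a i → edge a a i i ≡ false
    edge-irrefl true  i = cong not (is-refl i)
    edge-irrefl false i = refl

  initial : Graph N
  initial = record { adj = λ i j → edge (S i) (S j) i j
                   ; sym = λ i j → edge-sym (S i) (S j) i j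
                   ; irrefl = λ i → edge-irrefl (S i) i }

  private
    clique : CliqueOn s initial
    clique i j p q i≢j rewrite below-⇐ {k = s} {i} p | below-⇐ {k = s} {j} q = cong not (is-≢ {i = i} {j} (λ e → i≢j (≡-sym e)))

    indep : IndepAfter s initial
    indep i j p q rewrite dec-false (toℕ i <? s) (<⇒≯ p) | dec-false (toℕ j <? s) (<⇒≯ q) = refl

    sat : ∀ i → toℕ i < s → deg initial i ≡ π i
    sat u u<s = suc-injective (begin
      suc (deg initial u)                              ≡⟨ cong suc (count-split (adj initial u) S) ⟩
      suc (nbrs initial S u) + nbrs initial far u      ≡⟨ cong (_+ nbrs initial far u) (nbrs-clique initial S u su
                                                            (λ j sj j≢u → clique u j u<s (below-⇒ {k = s} {j} sj) (λ e → j≢u (≡-sym e)))) ⟩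
      count S + nbrs initial far u                     ≡⟨ cong₂ _+_ (count-below N s s≤N) (count-cong _ (chosen u) same) ⟩
      s + count (chosen u)                             ≡⟨ proj₂ (proj₂ (choice u)) su ⟩
      suc (π u)                                        ∎)
      where
      open ≡-Reasoning
      su : S u ≡ true
      su = below-⇐ {k = s} {u} u<s
      same : ∀ j → far j ∧ edge (S u) (S j) u j ≡ chosen u j
      same j = by (S u) (S j) refl su
        where
        by : ∀ a b → S j ≡ b → a ≡ true → not b ∧ edge a b u j ≡ chosen u j
        by true true  sj _ = ≡-sym (≢true (λ e → true≢false sj (proj₁ (chosen-far u j e))))
        by true false sj _ = refl

    bound : ∀ i → deg initial i ≤ π i
    bound x with toℕ x <? s
    ... | yes x<s = ≤-reflexive (sat x x<s)
    ... | no x≮s  = ≤-trans (count-mono _ (adj G₀ x) (λ j → sub (S x) (S j) (dec-false (toℕ x <? s) x≮s) j)) (≤-reflexive (R₀ x))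
      where
      sub : ∀ a b → a ≡ false → ∀ j → edge a b x j ≡ true → adj G₀ x j ≡ true
      sub false true _ j e = adj-sym G₀ (proj₂ (chosen-far j x e))

  start : Inv π s s initial
  start = inv (clique , indep) bound sat

clique-realization : ∀ {N} (π : Fin N → ℕ) → Nonincreasing π → Graphic π → ∀ s → 0 < s → s ≤ N →
                     (∀ i → toℕ i < s → s ≤ suc (π i)) → ManyOrLarge π s →
                     ∃ λ G → Realization π G × CliqueOn s G
clique-realization {N} π mono (G₀ , R₀) s 0<s s≤N big ml =
  let open Start π G₀ R₀ s s≤N big
      k , eq = m≤n⇒∃[o]m+o≡n s≤N
      H , inv (clique , _) _ sat = Filling.run π mono G₀ R₀ s 0<s ml k s eq ≤-refl initial start
  in H , (λ i → sat i (toℕ<n i)) , clique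

-- Trees

-- The list index records the vertices of a simple path, so that `lookup` turns a path into the
-- injective sequence demanded by `HasCycle`.
data Path {n} (G : Graph n) : Fin n → Fin n → List (Fin n) → Set where
  stop : ∀ u → Path G u u (u ∷ [])
  link : ∀ {u w v l} → adj G u w ≡ true → u ∉ l → Path G w v l → Path G u v (u ∷ l)

snoc : ∀ {n} {G : Graph n} {u v z l} → Path G u v l → adj G v z ≡ true → z ∉ l → Path G u z (l ++ z ∷ [])
snoc {z = z} (stop u) uz z∉ = link uz (λ { (here u≡z) → z∉ (here (≡-sym u≡z)) }) (stop z)
snoc {l = u ∷ l} (link uw u∉l p) vz z∉ = link uw fresh (snoc p vz (λ z∈ → z∉ (there z∈)))
  where
  fresh : u ∉ l ++ _ ∷ []
  fresh u∈ with ∈-++⁻ l u∈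
  ... | inj₁ u∈l          = u∉l u∈l
  ... | inj₂ (here u≡z)   = z∉ (here (≡-sym u≡z))

lookup-injective : ∀ {n} {G : Graph n} {u v l} → Path G u v l → ∀ i j → lookup l i ≡ lookup l j → i ≡ j
lookup-injective (stop u)                   zero    zero    _ = refl
lookup-injective (link _ _ _)               zero    zero    _ = refl
lookup-injective {l = u ∷ l} (link _ u∉ _)  zero    (suc j) e = contradiction (subst (_∈ l) (≡-sym e) (∈-lookup j)) u∉
lookup-injective {l = u ∷ l} (link _ u∉ _)  (suc i) zero    e = contradiction (subst (_∈ l) e (∈-lookup i)) u∉
lookup-injective (link _ _ p)               (suc i) (suc j) e = cong suc (lookup-injective p i j e)

lookup-adj : ∀ {n} {G : Graph n} {u v x l} → Path G u v (x ∷ l) →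
             ∀ i → adj G (lookup (x ∷ l) (inject₁ i)) (lookup l i) ≡ true
lookup-adj (link uw _ (stop _))       zero    = uw
lookup-adj (link uw _ (link _ _ _))   zero    = uw
lookup-adj (link _ _ p@(link _ _ _))  (suc i) = lookup-adj p i

lookup-last : ∀ {n} {G : Graph n} {u v x l} → Path G u v (x ∷ l) → lookup (x ∷ l) (fromℕ (length l)) ≡ v
lookup-last (stop _)                    = refl
lookup-last (link _ _ (stop _))         = refl
lookup-last (link _ _ p@(link _ _ _))   = lookup-last p

path⇒cycle : ∀ {n} {G : Graph n} {y y' z l} → Path G y y' l → y ≢ y' → z ∉ l →
             adj G z y ≡ true → adj G y' z ≡ true → HasCycle G
path⇒cycle (stop _) y≢y' _ _ _ = contradiction refl y≢y'
path⇒cycle {G = G} {z = z} {y ∷ x ∷ l} p@(link _ _ _) _ z∉ zy y'z =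
  length l , lookup (z ∷ y ∷ x ∷ l) , (λ {i} {j} → lookup-injective q i j) , lookup-adj q ,
  trans (cong (λ v → adj G v z) (lookup-last q)) y'z
  where
  q : Path G z _ (z ∷ y ∷ x ∷ l)
  q = link zy z∉ p
path⇒cycle {l = _ ∷ []} (link _ _ ()) _ _ _ _

insert : ∀ {n} → Fin n → (Fin n → Bool) → Fin n → Bool
insert z M i = is z i ∨ M i

insert-new : ∀ {n} (z : Fin n) M → insert z M z ≡ true
insert-new z M = cong (_∨ M z) (is-refl z)

insert-old : ∀ {n} (z : Fin n) M {i} → M i ≡ true → insert z M i ≡ true
insert-old z M {i} e = trans (cong (is z i ∨_) e) (Bool.∨-zeroʳ (is z i))

insert-⇒ : ∀ {n} (z : Fin n) M i → insert z M i ≡ true → i ≡ z ⊎ M i ≡ true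
insert-⇒ z M i e with i ≟ z
... | yes p = inj₁ p
... | no _  = inj₂ e

module Growth {t} (T : Graph t) (tree : IsTree T) where

  Joined : (Fin t → Bool) → Set
  Joined M = ∀ y y' → M y ≡ true → M y' ≡ true → ∃ λ l → Path T y y' l × (∀ {x} → x ∈ l → M x ≡ true)

  NewLeaf : (Fin t → Bool) → Fin t → Fin t → Set
  NewLeaf M y z = M y ≡ true × M z ≡ false × adj T y z ≡ true ×
                  (∀ y' → M y' ≡ true → adj T y' z ≡ true → y' ≡ y)

  exit : ∀ (M : Fin t → Bool) {u v} → Reach T u v → M u ≡ true → M v ≡ false →
         ∃ λ y → ∃ λ z → M y ≡ true × M z ≡ false × adj T y z ≡ true
  exit M here mu mv = ⊥-elim (true≢false mu mv)
  exit M {u} (step {w = w} uw p) mu mv with M w in mw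
  ... | true  = exit M p mw mv
  ... | false = u , w , mu , mw , uw

  -- A second neighbour `y'` of `z` in `M`, together with the path inside `M` from `y` to `y'`,
  -- would close a cycle.
  new-leaf : ∀ M → Joined M → ∀ {y z} → M y ≡ true → M z ≡ false → adj T y z ≡ true → NewLeaf M y z
  new-leaf M joined {y} {z} my mz yz = my , mz , yz , unique
    where
    unique : ∀ y' → M y' ≡ true → adj T y' z ≡ true → y' ≡ y
    unique y' my' y'z = decidable-stable (y' ≟ y) λ y'≢y →
      let l , p , within = joined y y' my my'
      in proj₂ tree (path⇒cycle p (λ e → y'≢y (≡-sym e)) (λ z∈ → true≢false (within z∈) mz) (adj-sym T yz) y'z)

  joined-insert : ∀ M {y z} → Joined M → NewLeaf M y z → Joined (insert z M)
  joined-insert M {y} {z} joined (my , mz , yz , _) a b ma mb with insert-⇒ z M a ma | insert-⇒ z M b mb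
  ... | inj₁ refl | inj₁ refl = z ∷ [] , stop z , λ { (here refl) → insert-new z M }
  ... | inj₁ refl | inj₂ mb'  =
    let l , p , within = joined y b my mb'
    in z ∷ l , link (adj-sym T yz) (λ z∈ → true≢false (within z∈) mz) p ,
       λ { (here refl) → insert-new z M ; (there x∈) → insert-old z M (within x∈) }
  ... | inj₂ ma'  | inj₁ refl =
    let l , p , within = joined a y ma' my
    in l ++ z ∷ [] , snoc p yz (λ z∈ → true≢false (within z∈) mz) ,
       λ x∈ → [ (λ x∈l → insert-old z M (within x∈l)) , (λ { (here refl) → insert-new z M }) ] (∈-++⁻ l x∈)
  ... | inj₂ ma'  | inj₂ mb'  =
    let l , p , within = joined a b ma' mb'
    in l , p , λ x∈ → insert-old z M (within x∈)

  -- Induction over a tree: starting from the root `ρ`, one leaf at a time is attached to a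
  -- connected vertex set. `Φ` may carry data, such as a partial colouring or a realization.
  grow : ∀ (ρ : Fin t) (Φ : (Fin t → Bool) → Set) → Φ (is ρ) →
         (∀ M y z → M ρ ≡ true → NewLeaf M y z → Φ M → Φ (insert z M)) →
         ∃ λ M → (∀ i → M i ≡ true) × Φ M
  grow ρ Φ base next = go t (is ρ) (is-refl ρ) joined₀ base (m≤n+m t _)
    where
    joined₀ : Joined (is ρ)
    joined₀ y y' my my' with does⇒ (y ≟ ρ) my | does⇒ (y' ≟ ρ) my'
    ... | refl | refl = ρ ∷ [] , stop ρ , λ { (here refl) → is-refl ρ }
    go : ∀ fuel M → M ρ ≡ true → Joined M → Φ M → t ≤ count M + fuel → ∃ λ M → (∀ i → M i ≡ true) × Φ M
    go fuel M mρ joined φ le with any? (λ v → M v Bool.≟ false)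
    ... | no ¬v = M , (λ i → ≢false (λ e → ¬v (i , e))) , φ
      where
      ≢false : ∀ {b} → b ≢ false → b ≡ true
      ≢false {true}  _ = refl
      ≢false {false} h = contradiction refl h
    go zero M mρ joined φ le | yes (v , mv) =
      contradiction (≤-trans le (≤-reflexive (+-identityʳ _)))
        (<⇒≱ (subst (count M <_) (count-all {t} (λ _ → true) (λ _ → refl)) (count-mono-< M (λ _ → true) (λ _ _ → refl) v refl mv)))
    go (suc fuel) M mρ joined φ le | yes (v , mv) =
      let y , z , my , mz , yz = exit M (proj₁ tree ρ v) mρ mv
          nl = new-leaf M joined my mz yz
          more : count M < count (insert z M)
          more = count-mono-< M (insert z M) (λ i mi → insert-old z M mi) z (insert-new z M) mz
      in go fuel (insert z M) (insert-old z M mρ) (joined-insert M joined nl) (next M y z mρ nl φ)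
           (≤-trans le (≤-trans (≤-reflexive (+-suc _ fuel)) (+-monoˡ-≤ fuel more)))

  -- Each new vertex has exactly one coloured neighbour and takes the opposite colour.
  two-colouring : Fin t → ∃ λ (col : Fin t → Bool) → ∀ i j → adj T i j ≡ true → col i ≢ col j
  two-colouring ρ =
    let M , all , col , proper = grow ρ Φ ((λ _ → true) , base) next
    in col , λ i j → proper i j (all i) (all j)
    where
    Φ : (Fin t → Bool) → Set
    Φ M = ∃ λ (col : Fin t → Bool) → ∀ i j → M i ≡ true → M j ≡ true → adj T i j ≡ true → col i ≢ col j
    base : ∀ i j → is ρ i ≡ true → is ρ j ≡ true → adj T i j ≡ true → true ≢ true
    base i j mi mj ij with does⇒ (i ≟ ρ) mi | does⇒ (j ≟ ρ) mj
    ... | refl | refl = λ _ → adj-≢ T ij refl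
    next : ∀ M y z → M ρ ≡ true → NewLeaf M y z → Φ M → Φ (insert z M)
    next M y z _ (my , mz , yz , unique) (col , proper) = col' , proper'
      where
      col' : Fin t → Bool
      col' i = if is z i then not (col y) else col i
      at-z : col' z ≡ not (col y)
      at-z rewrite is-refl z = refl
      off-z : ∀ i → M i ≡ true → col' i ≡ col i
      off-z i mi rewrite is-≢ {i = z} {i} (λ { refl → true≢false mi mz }) = refl
      not-≢ : ∀ b → not b ≢ b
      not-≢ true  ()
      not-≢ false ()
      proper' : ∀ i j → insert z M i ≡ true → insert z M j ≡ true → adj T i j ≡ true → col' i ≢ col' j
      proper' i j mi mj ij e with insert-⇒ z M i mi | insert-⇒ z M j mj
      ... | inj₁ refl | inj₁ refl = adj-≢ T ij refl
      ... | inj₁ refl | inj₂ mj' with unique j mj' (adj-sym T ij)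
      ...   | refl = not-≢ (col j) (trans (≡-sym at-z) (trans e (off-z j mj')))
      proper' i j mi mj ij e | inj₂ mi' | inj₁ refl with unique i mi' ij
      ...   | refl = not-≢ (col i) (trans (≡-sym at-z) (trans (≡-sym e) (off-z i mi')))
      proper' i j mi mj ij e | inj₂ mi' | inj₂ mj' =
        proper i j mi' mj' ij (trans (≡-sym (off-z i mi')) (trans e (off-z j mj')))

  leaf? : ∀ i → Dec (deg T i ≡ 1)
  leaf? i = deg T i Data.Nat.≟ 1

  leaf : Fin t → Bool
  leaf i = does (leaf? i)

  leaf-unique : ∀ {i y y'} → deg T i ≡ 1 → adj T i y ≡ true → adj T i y' ≡ true → y' ≡ y
  leaf-unique {i} {y} {y'} d iy iy' = decidable-stable (y' ≟ y) λ y'≢y →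
    let sub : ∀ j → is y j ≡ true → adj T i j ≡ true
        sub j e = subst (λ v → adj T i v ≡ true) (≡-sym (does⇒ (j ≟ y) e)) iy
        lt = count-mono-< (is y) (adj T i) sub y' iy' (is-≢ y'≢y)
    in <-irrefl (≡-sym d) (subst (_< deg T i) (count-is y) lt)

  -- The vertex attached last is a leaf: once all vertices are present, its one neighbour in `M` is
  -- its only neighbour. Accordingly `Φ` remembers just the latest step. Since that vertex differs
  -- from the root, a second run rooted at the leaf found yields another leaf.
  other-leaf : 2 ≤ t → ∀ ρ → ∃ λ z → z ≢ ρ × deg T z ≡ 1
  other-leaf 2≤t ρ with grow ρ Φ (inj₁ (λ i e → does⇒ (i ≟ ρ) e)) next
    where
    Φ : (Fin t → Bool) → Set
    Φ M = (∀ i → M i ≡ true → i ≡ ρ) ⊎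
          (∃ λ z → M z ≡ true × z ≢ ρ × ∃ λ y → adj T z y ≡ true × (∀ y' → M y' ≡ true → adj T z y' ≡ true → y' ≡ y))
    next : ∀ M y z → M ρ ≡ true → NewLeaf M y z → Φ M → Φ (insert z M)
    next M y z mρ (my , mz , yz , unique) _ =
      inj₂ (z , insert-new z M , (λ { refl → true≢false mρ mz }) , y , adj-sym T yz , λ y' my' zy' →
        [ (λ { refl → contradiction refl (adj-≢ T zy') }) , (λ m → unique y' m (adj-sym T zy')) ] (insert-⇒ z M y' my'))
  ... | M , all , inj₁ single = contradiction (injective⇒≤ {f = λ (_ : Fin t) → zero {0}} (λ {i} {j} _ → trans (single i (all i)) (≡-sym (single j (all j)))))
                                  (<⇒≱ 2≤t)
  ... | M , all , inj₂ (z , _ , z≢ρ , y , zy , unique) = z , z≢ρ , trans (count-cong (adj T z) (is y) same) (count-is y)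
    where
    same : ∀ j → adj T z j ≡ is y j
    same j with j ≟ y
    ... | yes refl = zy
    ... | no j≢y   = ≢true (λ e → j≢y (unique j (all j) e))

  two-leaves : 2 ≤ t → 2 ≤ leaves T
  two-leaves 2≤t =
    let ρ = fromℕ< (<-trans (s≤s z≤n) 2≤t)
        x , _ , dx = other-leaf 2≤t ρ
        y , y≢x , dy = other-leaf 2≤t x
        sub : ∀ j → is x j ≡ true → leaf j ≡ true
        sub j e = subst (λ v → leaf v ≡ true) (≡-sym (does⇒ (j ≟ x) e)) (dec-true (leaf? x) dx)
    in subst (_< leaves T) (count-is x) (count-mono-< (is x) leaf sub y (dec-true (leaf? y) dy) (is-≢ y≢x))

  -- If all degrees were 1, a vertex and its neighbour would form a whole component. The vertex
  -- found serves as the root of the embedding, which keeps leaves from becoming parents.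
  inner-vertex : 3 ≤ t → ∃ λ y → deg T y ≢ 1
  inner-vertex 3≤t with any? (λ y → ¬? (leaf? y))
  ... | yes w = w
  ... | no ¬w = contradiction small (<⇒≱ 3≤t)
    where
    all-leaf : ∀ i → deg T i ≡ 1
    all-leaf i = decidable-stable (leaf? i) (λ h → ¬w (i , h))
    a = fromℕ< (<-trans (s≤s z≤n) 3≤t)
    nbr = count-pos⇒∃ (adj T a) (≤-reflexive (≡-sym (all-leaf a)))
    b = proj₁ nbr
    ab = proj₂ nbr
    closed : ∀ {u v} → Reach T u v → u ≡ a ⊎ u ≡ b → v ≡ a ⊎ v ≡ b
    closed here h = h
    closed (step uw p) (inj₁ refl) = closed p (inj₂ (leaf-unique (all-leaf a) ab uw))
    closed (step uw p) (inj₂ refl) = closed p (inj₁ (leaf-unique (all-leaf b) (adj-sym T ab) uw))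
    small : t ≤ 2
    small = begin
      t                             ≡⟨ count-all {t} (λ _ → true) (λ _ → refl) ⟨
      count {t} (λ _ → true)        ≤⟨ count-∪ (λ _ → true) (is a) (is b)
                                         (λ v _ → Sum.map (dec-true (v ≟ a)) (dec-true (v ≟ b)) (closed (proj₁ tree a v) (inj₁ refl))) ⟩
      count (is a) + count (is b)   ≡⟨ cong₂ _+_ (count-is a) (count-is b) ⟩
      2                             ∎
      where open ≤-Reasoning

  near-leaf? : ∀ i → Dec (∃ λ j → leaf j ≡ true × adj T i j ≡ true)
  near-leaf? i = any? (λ j → (leaf j Bool.≟ true) ×-dec (adj T i j Bool.≟ true))

  deep : Fin t → Bool
  deep i = not (leaf i) ∧ not (does (near-leaf? i))

  -- Each leaf has a single neighbour, so at most `leaves T` vertices are adjacent to a leaf.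
  count-deep : t ≤ count deep + (leaves T + leaves T)
  count-deep = begin
    t                                         ≡⟨ count-all {t} (λ _ → true) (λ _ → refl) ⟨
    count {t} (λ _ → true)                    ≤⟨ count-∪ (λ _ → true) deep (not ∘ deep) either ⟩
    count deep + count (not ∘ deep)           ≤⟨ +-monoʳ-≤ (count deep) (count-∪ (not ∘ deep) leaf near cases) ⟩
    count deep + (leaves T + count near)      ≤⟨ +-monoʳ-≤ (count deep) (+-monoʳ-≤ (leaves T) few) ⟩
    count deep + (leaves T + leaves T)        ∎
    where
    open ≤-Reasoning
    near : Fin t → Bool
    near i = does (near-leaf? i)
    either : ∀ i → true ≡ true → deep i ≡ true ⊎ not (deep i) ≡ true
    either i _ with deep i
    ... | true  = inj₁ refl
    ... | false = inj₂ refl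
    cases : ∀ i → not (deep i) ≡ true → leaf i ≡ true ⊎ near i ≡ true
    cases i e with leaf i | near i
    ... | true  | _    = inj₁ refl
    ... | false | true = inj₂ refl
    few : count near ≤ leaves T
    few = begin
      count near                                ≡⟨ count≡sum near ⟩
      sum (𝟙 ∘ near)                            ≤⟨ sum-mono-≤ pointwise ⟩
      sumOn (λ _ → true) (nbrs T leaf)          ≡⟨ double-count T (λ _ → true) leaf ⟩
      sumOn leaf (nbrs T (λ _ → true))          ≡⟨ sumOn-cong leaf (λ i e → does⇒ (leaf? i) e) ⟩
      sumOn leaf (λ _ → 1)                      ≡⟨ sumOn-const leaf 1 ⟩
      leaves T * 1                              ≡⟨ *-identityʳ _ ⟩
      leaves T                                  ∎
      where
      pointwise : ∀ i → 𝟙 (near i) ≤ nbrs T leaf i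
      pointwise i with near i in e
      ... | false = z≤n
      ... | true  = let j , lj , ij = does⇒ (near-leaf? i) e in count-pos _ j (⇒∧ lj ij)

-- Embedding a tree in the complement of some realization

-- Sorts by level, with ties broken by index: the key is a lexicographic pair written in base `t`,
-- and the rank is the number of smaller keys.
module Ranking {t} (cl : Fin t → ℕ) where

  key : Fin t → ℕ
  key x = cl x * t + toℕ x

  key-mono : ∀ {x y} → cl x < cl y → key x < key y
  key-mono {x} {y} lt = begin-strict
    cl x * t + toℕ x   <⟨ +-monoʳ-< (cl x * t) (toℕ<n x) ⟩
    cl x * t + t       ≡⟨ +-comm (cl x * t) t ⟩
    suc (cl x) * t     ≤⟨ *-monoˡ-≤ t lt ⟩
    cl y * t           ≤⟨ m≤m+n _ _ ⟩
    key y              ∎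
    where open ≤-Reasoning

  key-injective : ∀ {x y} → key x ≡ key y → x ≡ y
  key-injective {x} {y} e with <-cmp (cl x) (cl y)
  ... | tri< lt _ _ = contradiction e (<⇒≢ (key-mono lt))
  ... | tri> _ _ gt = contradiction (≡-sym e) (<⇒≢ (key-mono gt))
  ... | tri≈ _ c _  = toℕ-injective (+-cancelˡ-≡ (cl x * t) _ _ (trans e (cong (λ v → v * t + toℕ y) (≡-sym c))))

  before : Fin t → Fin t → Bool
  before x y = does (key y <? key x)

  rank : Fin t → ℕ
  rank x = count (before x)

  rank-mono : ∀ {x y} → key x < key y → rank x < rank y
  rank-mono {x} {y} lt = count-mono-< (before x) (before y)
    (λ i e → dec-true (key i <? key y) (<-trans (does⇒ (key i <? key x) e) lt))
    x (dec-true (key x <? key y) lt) (dec-false (key x <? key x) (<-irrefl refl))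

  rank-injective : ∀ {x y} → rank x ≡ rank y → x ≡ y
  rank-injective {x} {y} e with <-cmp (key x) (key y)
  ... | tri< lt _ _ = contradiction e (<⇒≢ (rank-mono lt))
  ... | tri> _ _ gt = contradiction (≡-sym e) (<⇒≢ (rank-mono gt))
  ... | tri≈ _ c _  = key-injective c

  rank<t : ∀ x → rank x < t
  rank<t x = subst (rank x <_) (count-all {t} (λ _ → true) (λ _ → refl))
    (count-mono-< (before x) (λ _ → true) (λ _ _ → refl) x refl (dec-false (key x <? key x) (<-irrefl refl)))

  rank-≥ : ∀ x (p : Fin t → Bool) → (∀ y → p y ≡ true → cl y < cl x) → count p ≤ rank x
  rank-≥ x p h = count-mono p (before x) (λ y e → dec-true (key y <? key x) (key-mono (h y e)))

-- Since d(c) ≥ d(b'), some neighbour e of c can take over b' while b becomes adjacent to c instead of b'.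
separate : ∀ {N} (π : Fin N → ℕ) (G : Graph N) → Realization π G → ∀ b b' c →
           adj G b b' ≡ true → c ≢ b → adj G b c ≡ false → π b' ≤ π c →
           ∃ λ G' → Realization π G' × adj G' b b' ≡ false ×
                    (∀ i j → i ≢ b' → j ≢ b' → ¬ ((i ≡ b × j ≡ c) ⊎ (i ≡ c × j ≡ b)) →
                     adj G i j ≡ false → adj G' i j ≡ false)
separate {N} π G R b b' c bb' c≢b bc πle = R₂.rotate , real , apart , frame
  where
  b≢c : b ≢ c
  b≢c e = c≢b (≡-sym e)
  b'≢b : b' ≢ b
  b'≢b e = adj-≢ G bb' (≡-sym e)
  P Q : Fin N → Bool
  P i = not (is b' i) ∧ adj G c i
  Q i = not (is c i) ∧ adj G b' i
  Q≤P : count Q ≤ count P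
  Q≤P = +-cancelˡ-≤ (𝟙 (adj G c b')) _ _ (begin
    𝟙 (adj G c b') + count Q   ≡⟨ cong (λ v → 𝟙 v + count Q) (Graph.sym G c b') ⟩
    𝟙 (adj G b' c) + count Q   ≡⟨ count-remove (adj G b') c ⟨
    deg G b'                   ≡⟨ R b' ⟩
    π b'                       ≤⟨ πle ⟩
    π c                        ≡⟨ R c ⟨
    deg G c                    ≡⟨ count-remove (adj G c) b' ⟩
    𝟙 (adj G c b') + count P   ∎)
    where open ≤-Reasoning
  -- The edge `c b'`, if present, is discounted on both sides. Since `b` lies in `Q` but not in `P`,
  -- while `Q` is not larger, some `e` lies in `P` but not in `Q`.
  found = count-≤⇒∖ P Q Q≤P b
    (⇒∧ (cong not (is-≢ b≢c)) (adj-sym G bb'))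
    (trans (cong (not (is b' b) ∧_) (adj-sym G bc)) (Bool.∧-zeroʳ _))
  e = proj₁ found
  e≢b' : e ≢ b'
  e≢b' = does⇏ (e ≟ b') (not⇒ (proj₁ (∧⇒ {not (is b' e)} (proj₁ (proj₂ found)))))
  ce : adj G c e ≡ true
  ce = proj₂ (∧⇒ {not (is b' e)} (proj₁ (proj₂ found)))
  e≢c : e ≢ c
  e≢c h = adj-≢ G ce (≡-sym h)
  e≢b : e ≢ b
  e≢b h = true≢false (subst (λ v → adj G c v ≡ true) h ce) (adj-sym G bc)
  b'e : adj G b' e ≡ false
  b'e = trans (cong (λ v → not v ∧ adj G b' e) (≡-sym (is-≢ e≢c))) (proj₂ (proj₂ found))
  module R₁ = Rotate G {b} {b'} {c} b≢c bb' bc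
  ec₁ : adj R₁.rotate e c ≡ true
  ec₁ = trans (R₁.rotate-away e≢b c≢b) (adj-sym G ce)
  eb'₁ : adj R₁.rotate e b' ≡ false
  eb'₁ = trans (R₁.rotate-away e≢b b'≢b) (adj-sym G b'e)
  module R₂ = Rotate R₁.rotate {e} {c} {b'} e≢b' ec₁ eb'₁
  real : Realization π R₂.rotate
  real i = trans (+-cancelʳ-≡ (𝟙 (is b' i) + 𝟙 (is c i)) _ _ (begin
    D₂ + (B' + C)      ≡⟨ swap D₂ B' C ⟩
    D₂ + C + B'        ≡⟨ cong (_+ B') (R₂.rotate-deg i) ⟩
    D₁ + B' + B'       ≡⟨ cong (_+ B') (R₁.rotate-deg i) ⟩
    deg G i + C + B'   ≡⟨ swap (deg G i) B' C ⟨
    deg G i + (B' + C) ∎)) (R i)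
    where
    open ≡-Reasoning
    D₁ = deg R₁.rotate i
    D₂ = deg R₂.rotate i
    B' = 𝟙 (is b' i)
    C = 𝟙 (is c i)
    swap : ∀ d x y → d + (x + y) ≡ d + y + x
    swap = solve-∀
  apart : adj R₂.rotate b b' ≡ false
  apart = trans (R₂.rotate-away (λ h → e≢b (≡-sym h)) (λ h → e≢b' (≡-sym h))) R₁.rotate-old
  frame : ∀ i j → i ≢ b' → j ≢ b' → ¬ ((i ≡ b × j ≡ c) ⊎ (i ≡ c × j ≡ b)) →
          adj G i j ≡ false → adj R₂.rotate i j ≡ false
  frame i j i≢b' j≢b' off ij = R₂.rotate-false [ (λ (_ , h) → j≢b' h) , (λ (h , _) → i≢b' h) ] (R₁.rotate-false off ij)

data Class : Set where
  end mid body : Class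

-- `low` and `middle` express that both clique conditions fail. In 0-based indices, 3 + (k + k) = 2s
-- - 1 is the place of d_{2s}, and 2 + k = s is the place of d_{s+1}.
module Embed (k t : ℕ) (T : Graph t) (tree : IsTree T)
             (π : Fin (k + t) → ℕ) (mono : Nonincreasing π) (graphic : Graphic π)
             (low : ∀ i → 3 + (k + k) ≤ toℕ i → π i ≤ k)
             (middle : ∀ i → 2 + k ≤ toℕ i → π i ≤ suc (k + k))
             (J : Fin t → Bool) where

  open Growth T tree

  module _ (J-deep : ∀ i → J i ≡ true → deep i ≡ true)
           (J-indep : ∀ i j → J i ≡ true → J j ≡ true → adj T i j ≡ false)
           (2≤ℓ : 2 ≤ leaves T) (enough : 3 + k ≤ leaves T + count J) where

    class : Bool → Bool → Class
    class true  _     = end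
    class false true  = mid
    class false false = body

    level : Class → ℕ
    level end  = 0
    level mid  = 1
    level body = 2

    cl : Fin t → Class
    cl x = class (leaf x) (J x)

    end-leaf : ∀ x → cl x ≡ end → deg T x ≡ 1
    end-leaf x e with leaf x in lx | J x
    ... | true  | _    = does⇒ (leaf? x) lx
    end-leaf x () | false | true
    end-leaf x () | false | false

    mid-J : ∀ x → cl x ≡ mid → J x ≡ true
    mid-J x e with leaf x | J x
    ... | false | true = refl
    mid-J x () | true | _
    mid-J x () | false | false

    -- Such a neighbour is no leaf, because `J` is deep, and not in `J`, because `J` is independent.
    -- This puts all tree neighbours of `J` at the large indices, away from the candidates for c.
    mid-nbr : ∀ x y → cl x ≡ mid → adj T x y ≡ true → cl y ≡ body
    mid-nbr x y cx xy = cong₂ class not-leaf not-J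
      where
      jx = mid-J x cx
      not-leaf : leaf y ≡ false
      not-leaf = ≢true (λ ly → does⇏ (near-leaf? x) (not⇒ (proj₂ (∧⇒ {not (leaf x)} (J-deep x jx)))) (y , ly , xy))
      not-J : J y ≡ false
      not-J = ≢true (λ jy → true≢false xy (J-indep x y jx jy))

    open Ranking (level ∘ cl)

    -- Leaves come first, then J, then the other vertices; the k largest degrees stay unused.
    φ : Fin t → Fin (k + t)
    φ x = fromℕ< (+-monoʳ-< k (rank<t x))

    toℕ-φ : ∀ x → toℕ (φ x) ≡ k + rank x
    toℕ-φ x = toℕ-fromℕ< (+-monoʳ-< k (rank<t x))

    φ-injective : ∀ {x y} → φ x ≡ φ y → x ≡ y
    φ-injective {x} {y} e = rank-injective (+-cancelˡ-≡ k _ _ (trans (≡-sym (toℕ-φ x)) (trans (cong toℕ e) (toℕ-φ y))))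

    φ-all : ∀ x → k ≤ toℕ (φ x)
    φ-all x = subst (k ≤_) (≡-sym (toℕ-φ x)) (m≤m+n k _)

    φ-mid : ∀ x → cl x ≡ mid → 2 + k ≤ toℕ (φ x)
    φ-mid x cx = begin
      2 + k          ≡⟨ +-comm 2 k ⟩
      k + 2          ≤⟨ +-monoʳ-≤ k (≤-trans 2≤ℓ (rank-≥ x leaf below-mid)) ⟩
      k + rank x     ≡⟨ toℕ-φ x ⟨
      toℕ (φ x)      ∎
      where
      open ≤-Reasoning
      below-mid : ∀ y → leaf y ≡ true → level (cl y) < level (cl x)
      below-mid y ly rewrite cx | ly = s≤s z≤n

    φ-body : ∀ x → cl x ≡ body → 3 + (k + k) ≤ toℕ (φ x)
    φ-body x cx = begin
      3 + (k + k)    ≡⟨ arith k ⟩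
      k + (3 + k)    ≤⟨ +-monoʳ-≤ k (≤-trans enough (≤-trans (≤-reflexive (≡-sym union)) (rank-≥ x (λ y → leaf y ∨ J y) below-body))) ⟩
      k + rank x     ≡⟨ toℕ-φ x ⟨
      toℕ (φ x)      ∎
      where
      open ≤-Reasoning
      arith : ∀ k → 3 + (k + k) ≡ k + (3 + k)
      arith = solve-∀
      union : count (λ y → leaf y ∨ J y) ≡ leaves T + count J
      union = count-+ (λ y → leaf y ∨ J y) leaf J pointwise
        where
        pointwise : ∀ y → 𝟙 (leaf y ∨ J y) ≡ 𝟙 (leaf y) + 𝟙 (J y)
        pointwise y with leaf y in ly | J y in jy
        ... | true  | true  = ⊥-elim (true≢false ly (not⇒ (proj₁ (∧⇒ {not (leaf y)} (J-deep y jy)))))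
        ... | true  | false = refl
        ... | false | _     = refl
      below-body : ∀ y → (leaf y ∨ J y) ≡ true → level (cl y) < level (cl x)
      below-body y e rewrite cx with leaf y | J y
      ... | true  | _    = s≤s z≤n
      ... | false | true = s≤s (s≤s z≤n)

    -- The second part keeps leaves from becoming parents: a placed leaf already has its only
    -- neighbour placed.
    Placed : (Fin t → Bool) → Set
    Placed M = (∃ λ G → Realization π G ×
                 (∀ i j → M i ≡ true → M j ≡ true → adj T i j ≡ true → adj G (φ i) (φ j) ≡ false))
             × (∀ i → M i ≡ true → cl i ≡ end → ∃ λ j → M j ≡ true × adj T i j ≡ true)

    Partner : Graph (k + t) → Fin t → Fin t → Set
    Partner G y z = ∃ λ c → toℕ c ≤ toℕ (φ z) × adj G (φ y) c ≡ false × c ≢ φ y ×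
                            (∀ i → adj T y i ≡ true → i ≢ z → φ i ≢ c)

    -- The images have index ≥ k, so at most k + (m − k) of the m + 1 vertices up to φ z are excluded.
    body-partner : ∀ G → Realization π G → ∀ y z → y ≢ z → cl y ≡ body → Partner G y z
    body-partner G R y z y≢z cly = c , c≤ , proj₁ parts , only y y≢z , λ i _ i≢z e → only i i≢z (≡-sym e)
      where
      m = toℕ (φ z)
      b = φ y
      q : Fin (k + t) → Bool
      q c = adj G b c ∨ between k m c
      few : count q < count {k + t} (below (suc m))
      few = begin-strict
        count q                          ≤⟨ count-∪ q (adj G b) (between k m) (λ i → ∨⇒) ⟩
        deg G b + count {k + t} (between k m) ≤⟨ +-monoˡ-≤ _ (≤-trans (≤-reflexive (R b)) (low b (φ-body y cly))) ⟩
        k + count {k + t} (between k m)  ≡⟨ count-between (k + t) k m (φ-all z) (<⇒≤ (toℕ<n (φ z))) ⟩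
        m                                <⟨ n<1+n m ⟩
        suc m                            ≡⟨ count-below (k + t) (suc m) (toℕ<n (φ z)) ⟨
        count {k + t} (below (suc m))    ∎
        where open ≤-Reasoning
      found = count-<⇒∖ (below (suc m)) q few
      c = proj₁ found
      c≤ : toℕ c ≤ m
      c≤ = ≤-pred (below-⇒ {k = suc m} {c} (proj₁ (proj₂ found)))
      parts = ∨-false (proj₂ (proj₂ found))
      only : ∀ i → i ≢ z → c ≢ φ i
      only i i≢z e = true≢false (between-⇐ {l = k} {m} c (subst (λ v → k ≤ toℕ v) (≡-sym e) (φ-all i))
        (≤∧≢⇒< c≤ (λ h → i≢z (φ-injective (trans (≡-sym e) (toℕ-injective h)))))) (proj₂ parts)

    -- All tree neighbours of y have image index ≥ L = 2k + 3, so at most (2k + 1) + 1 + (m − L) vertices are excluded.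
    mid-partner : ∀ G → Realization π G → ∀ y z → adj T y z ≡ true → cl y ≡ mid → Partner G y z
    mid-partner G R y z yz cly = c , c≤ , proj₁ parts , does⇏ (c ≟ b) (proj₁ (∨-false (proj₂ parts))) , only
      where
      m = toℕ (φ z)
      b = φ y
      L = 3 + (k + k)
      cz : cl z ≡ body
      cz = mid-nbr y z cly yz
      q : Fin (k + t) → Bool
      q c = adj G b c ∨ (is b c ∨ between L m c)
      few : count q < count {k + t} (below (suc m))
      few = begin-strict
        count q                                              ≤⟨ count-∪ q (adj G b) (λ c → is b c ∨ between L m c) (λ i → ∨⇒) ⟩
        deg G b + count (λ c → is b c ∨ between L m c)        ≤⟨ +-mono-≤ (≤-trans (≤-reflexive (R b)) (middle b (φ-mid y cly)))
                                                                   (count-∪ _ (is b) (between L m) (λ i → ∨⇒)) ⟩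
        suc (k + k) + (count (is b) + count {k + t} (between L m)) ≡⟨ cong (λ v → suc (k + k) + (v + count {k + t} (between L m))) (count-is b) ⟩
        suc (k + k) + suc (count {k + t} (between L m))       <⟨ ≤-reflexive (arith k (count {k + t} (between L m))) ⟩
        L + count {k + t} (between L m)                       ≡⟨ count-between (k + t) L m (φ-body z cz) (<⇒≤ (toℕ<n (φ z))) ⟩
        m                                                    <⟨ n<1+n m ⟩
        suc m                                                ≡⟨ count-below (k + t) (suc m) (toℕ<n (φ z)) ⟨
        count {k + t} (below (suc m))                        ∎
        where
        open ≤-Reasoning
        arith : ∀ k x → suc (suc (k + k) + suc x) ≡ 3 + (k + k) + x
        arith = solve-∀
      found = count-<⇒∖ (below (suc m)) q few
      c = proj₁ found
      c≤ : toℕ c ≤ m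
      c≤ = ≤-pred (below-⇒ {k = suc m} {c} (proj₁ (proj₂ found)))
      parts = ∨-false (proj₂ (proj₂ found))
      only : ∀ i → adj T y i ≡ true → i ≢ z → φ i ≢ c
      only i yi i≢z e = true≢false (between-⇐ {l = L} {m} c (subst (λ v → L ≤ toℕ v) e (φ-body i (mid-nbr y i cly yi)))
        (≤∧≢⇒< c≤ (λ h → i≢z (φ-injective (trans e (toℕ-injective h)))))) (proj₂ (∨-false (proj₂ parts)))

    partner : ∀ G → Realization π G → ∀ y z → adj T y z ≡ true → cl y ≢ end → Partner G y z
    partner G R y z yz cy = by (cl y) refl
      where
      by : ∀ c → cl y ≡ c → Partner G y z
      by end  e = contradiction e cy
      by mid  e = mid-partner G R y z yz e
      by body e = body-partner G R y z (adj-≢ T yz) e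

    place : ∀ M y z → NewLeaf M y z → Placed M → Placed (insert z M)
    place M y z (my , mz , yz , unique) ((G , R , apart) , parents) = placed , parents'
      where
      y≢z : y ≢ z
      y≢z = adj-≢ T yz
      parents' : ∀ i → insert z M i ≡ true → cl i ≡ end → ∃ λ j → insert z M j ≡ true × adj T i j ≡ true
      parents' i mi ci with insert-⇒ z M i mi
      ... | inj₁ refl = y , insert-old z M my , adj-sym T yz
      ... | inj₂ mi'  = let j , mj , ij = parents i mi' ci in j , insert-old z M mj , ij
      not-end : cl y ≢ end
      not-end cy = let j , mj , yj = parents y my cy
                   in true≢false (subst (λ v → M v ≡ true) (leaf-unique (end-leaf y cy) yz yj) mj) mz
      extend : ∀ G' → adj G' (φ y) (φ z) ≡ false →
               (∀ i j → M i ≡ true → M j ≡ true → adj T i j ≡ true → adj G' (φ i) (φ j) ≡ false) →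
               ∀ i j → insert z M i ≡ true → insert z M j ≡ true → adj T i j ≡ true → adj G' (φ i) (φ j) ≡ false
      extend G' new old i j mi mj ij with insert-⇒ z M i mi | insert-⇒ z M j mj
      ... | inj₁ refl | inj₁ refl = contradiction refl (adj-≢ T ij)
      ... | inj₁ refl | inj₂ mj' with unique j mj' (adj-sym T ij)
      ...   | refl = adj-sym G' new
      extend G' new old i j mi mj ij | inj₂ mi' | inj₁ refl with unique i mi' ij
      ...   | refl = new
      extend G' new old i j mi mj ij | inj₂ mi' | inj₂ mj' = old i j mi' mj' ij
      placed : ∃ λ G → Realization π G ×
               (∀ i j → insert z M i ≡ true → insert z M j ≡ true → adj T i j ≡ true → adj G (φ i) (φ j) ≡ false)
      placed with adj G (φ y) (φ z) in bb'
      ... | false = G , R , extend G bb' apart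
      ... | true  =
        -- The exchange creates edges only at `φ z` and between `φ y` and `c`. The former are
        -- harmless because `y` is the only placed neighbour of `z`, and `new` treats that pair; the
        -- latter is no image of a tree edge by `avoid`.
        let c , c≤ , bc , c≢b , avoid = partner G R y z yz not-end
            G' , R' , new , frame = separate π G R (φ y) (φ z) c bb' c≢b bc (mono c (φ z) c≤)
            off : ∀ i → M i ≡ true → φ i ≢ φ z
            off i mi e = true≢false (subst (λ v → M v ≡ true) (φ-injective e) mi) mz
            clear : ∀ i j → M j ≡ true → adj T i j ≡ true → ¬ (φ i ≡ φ y × φ j ≡ c)
            clear i j mj ij (e , e') = avoid j (subst (λ v → adj T v j ≡ true) (φ-injective e) ij)
                                         (λ { refl → true≢false mj mz }) e'
        in G' , R' , extend G' new (λ i j mi mj ij →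
             frame (φ i) (φ j) (off i mi) (off j mj)
               [ clear i j mj ij , (λ (e , e') → clear j i mi (adj-sym T ij) (e' , e)) ] (apart i j mi mj ij))

    embedding : ∀ ρ → deg T ρ ≢ 1 →
                ∃ λ G → Realization π G × ∃ λ (f : Fin t → Fin (k + t)) → Injective _≡_ _≡_ f ×
                  (∀ i j → adj T i j ≡ true → adj G (f i) (f j) ≡ false)
    embedding ρ inner =
      let M , all , (G , R , apart) , _ = grow ρ Placed base (λ M y z _ → place M y z)
      in G , R , φ , φ-injective , λ i j → apart i j (all i) (all j)
      where
      base : Placed (is ρ)
      base = (proj₁ graphic , proj₂ graphic , λ i j mi mj ij → contradiction
                (trans (does⇒ (i ≟ ρ) mi) (≡-sym (does⇒ (j ≟ ρ) mj))) (adj-≢ T ij))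
           , λ i mi ci → contradiction (subst (λ v → deg T v ≡ 1) (does⇒ (i ≟ ρ) mi) (end-leaf i ci)) inner

-- Complements of realizations

count-opposite : ∀ {n} (p : Fin n → Bool) → count (p ∘ opposite) ≡ count p
count-opposite p = trans (count≡sum (p ∘ opposite)) (trans (≡-sym (sum-permute (𝟙 ∘ p) reverse)) (≡-sym (count≡sum p)))

-- The vertices are renamed by `opposite`, so that the degrees appear in the reversed order used by
-- `complementSeq`.
complement : ∀ {n} → Graph n → Graph n
adj (complement G) i j = not (adj G (opposite i) (opposite j)) ∧ not (is (opposite i) (opposite j))
Graph.sym (complement G) i j = cong₂ (λ a b → not a ∧ not b) (Graph.sym G (opposite i) (opposite j)) (is-comm (opposite i) (opposite j))
irrefl (complement G) i = trans (cong (λ v → not (adj G (opposite i) (opposite i)) ∧ not v) (is-refl (opposite i))) (Bool.∧-zeroʳ _)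

deg-complement : ∀ {n} (G : Graph n) i → deg (complement G) i ≡ (n ∸ 1) ∸ deg G (opposite i)
deg-complement {n} G i = begin
  deg (complement G) i                        ≡⟨ count-opposite rest ⟩
  count rest                                  ≡⟨ m+n∸m≡n (deg G u) (count rest) ⟨
  (deg G u + count rest) ∸ deg G u            ≡⟨ cong (_∸ deg G u) total ⟩
  (n ∸ 1) ∸ deg G u                           ∎
  where
  open ≡-Reasoning
  u = opposite i
  rest : Fin n → Bool
  rest j = not (adj G u j) ∧ not (is u j)
  total : deg G u + count rest ≡ n ∸ 1
  total = cong (_∸ 1) (begin
    suc (deg G u + count rest)                  ≡⟨ +-suc (deg G u) (count rest) ⟨
    deg G u + suc (count rest)                  ≡⟨ cong (λ v → deg G u + (v + count rest)) (count-is u) ⟨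
    deg G u + (count (is u) + count rest)       ≡⟨ cong (deg G u +_) (count-+ (not ∘ adj G u) (is u) rest parts) ⟨
    deg G u + count (not ∘ adj G u)             ≡⟨ count-+ (λ _ → true) (adj G u) (not ∘ adj G u) whole ⟨
    count {n} (λ _ → true)                      ≡⟨ count-all {n} (λ _ → true) (λ _ → refl) ⟩
    n                                           ∎)
    where
    parts : ∀ j → 𝟙 (not (adj G u j)) ≡ 𝟙 (is u j) + 𝟙 (rest j)
    parts j with j ≟ u
    ... | yes refl rewrite irrefl G j = refl
    ... | no _     = cong 𝟙 (≡-sym (Bool.∧-identityʳ _))
    whole : ∀ j → 1 ≡ 𝟙 (adj G u j) + 𝟙 (not (adj G u j))
    whole j with adj G u j
    ... | true  = refl
    ... | false = refl

complement-graphic : ∀ {h n} (H : Graph h) (π : Fin n → ℕ) (G : Graph n) → Realization π G →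
                     (f : Fin h → Fin n) → Injective _≡_ _≡_ f →
                     (∀ i j → adj H i j ≡ true → adj G (f i) (f j) ≡ false) →
                     PotentiallyGraphic H (complementSeq π)
complement-graphic {n = n} H π G R f inj apart =
  complement G , (λ i → trans (deg-complement G i) (cong ((n ∸ 1) ∸_) (R (opposite i)))) ,
  opposite ∘ f , (λ e → inj (trans (≡-sym (opposite-involutive _)) (trans (cong opposite e) (opposite-involutive _)))) ,
  λ u v uv → subst₂ (λ a b → (not (adj G a b) ∧ not (is a b)) ≡ true)
    (≡-sym (opposite-involutive (f u))) (≡-sym (opposite-involutive (f v)))
    (⇒∧ (cong not (apart u v uv)) (cong not (is-≢ (λ e → adj-≢ H uv (inj (≡-sym e))))))

-- The extremal sequence: a vertices of full degree joined to an independent set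

-- Double counting of the pairs of `u` and `f u`: by injectivity each value has at most one
-- preimage.
count-image : ∀ {h n} (f : Fin h → Fin n) → Injective _≡_ _≡_ f → (p : Fin h → Bool) (q : Fin n → Bool) →
              (∀ u → p u ≡ true → q (f u) ≡ true) → count p ≤ count q
count-image {h} {n} f inj p q sub = begin
  count p                                              ≡⟨ count≡sum p ⟩
  sum (𝟙 ∘ p)                                          ≡⟨ sum-cong-≗ spread ⟩
  sum (λ u → sum (λ v → 𝟙 (p u ∧ is (f u) v)))         ≡⟨ ∑-comm (λ u v → 𝟙 (p u ∧ is (f u) v)) ⟩
  sum (λ v → sum (λ u → 𝟙 (p u ∧ is (f u) v)))         ≤⟨ sum-mono-≤ collect ⟩
  sum (𝟙 ∘ q)                                          ≡⟨ count≡sum q ⟨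
  count q                                              ∎
  where
  open ≤-Reasoning
  spread : ∀ u → 𝟙 (p u) ≡ sum (λ v → 𝟙 (p u ∧ is (f u) v))
  spread u with p u
  ... | true  = trans (≡-sym (count-is (f u))) (count≡sum (is (f u)))
  ... | false = trans (≡-sym (count-none {n} _ (λ _ → refl))) (count≡sum {n} (λ _ → false))
  collect : ∀ v → sum (λ u → 𝟙 (p u ∧ is (f u) v)) ≤ 𝟙 (q v)
  collect v = subst (_≤ 𝟙 (q v)) (count≡sum fibre) (bound (any? (λ u → fibre u Bool.≟ true)))
    where
    fibre : Fin h → Bool
    fibre u = p u ∧ is (f u) v
    bound : Dec (∃ λ u → fibre u ≡ true) → count fibre ≤ 𝟙 (q v)
    bound (no none) = subst (_≤ 𝟙 (q v)) (≡-sym (count-none fibre (λ u → ≢true (λ e → none (u , e))))) z≤n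
    bound (yes (u , e)) =
      let pu , fu = ∧⇒ {p u} e
          v≡fu = does⇒ (v ≟ f u) fu
          qv : q v ≡ true
          qv = subst (λ w → q w ≡ true) (≡-sym v≡fu) (sub u pu)
          single : ∀ w → fibre w ≡ true → is u w ≡ true
          single w e' = dec-true (w ≟ u) (inj (trans (≡-sym (does⇒ (v ≟ f w) (proj₂ (∧⇒ {p w} e')))) v≡fu))
      in ≤-trans (count-mono fibre (is u) single) (≤-reflexive (trans (count-is u) (cong 𝟙 (≡-sym qv))))

image-size : ∀ {h n} (f : Fin h → Fin n) → Injective _≡_ _≡_ f → (q : Fin n → Bool) →
             (∀ u → q (f u) ≡ true) → h ≤ count q
image-size {h} f inj q sub = subst (_≤ count q) (count-all {h} (λ _ → true) (λ _ → refl))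
  (count-image f inj (λ _ → true) q (λ u _ → sub u))

count-others : ∀ {n} (i : Fin n) → suc (count (λ j → not (is i j))) ≡ n
count-others {n} i = begin
  suc (count (λ j → not (is i j)))               ≡⟨ cong (_+ count (λ j → not (is i j))) (count-is i) ⟨
  count (is i) + count (λ j → not (is i j))      ≡⟨ count-+ (λ _ → true) (is i) (λ j → not (is i j)) pointwise ⟨
  count {n} (λ _ → true)                         ≡⟨ count-all {n} (λ _ → true) (λ _ → refl) ⟩
  n                                              ∎
  where
  open ≡-Reasoning
  pointwise : ∀ j → 1 ≡ 𝟙 (is i j) + 𝟙 (not (is i j))
  pointwise j with is i j
  ... | true  = refl
  ... | false = refl

clique-join-independent : ∀ n → ℕ → Graph n
adj (clique-join-independent n a) i j = (below a i ∨ below a j) ∧ not (is i j)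
Graph.sym (clique-join-independent n a) i j =
  cong₂ (λ x y → x ∧ not y) (Bool.∨-comm (below a i) (below a j)) (is-comm i j)
irrefl (clique-join-independent n a) i = trans (cong (λ v → (below a i ∨ below a i) ∧ not v) (is-refl i)) (Bool.∧-zeroʳ _)

module Extremal (n a : ℕ) (a≤n : a ≤ n) where

  G : Graph n
  G = clique-join-independent n a

  π : Fin n → ℕ
  π = deg G

  π-full : ∀ i → toℕ i < a → suc (π i) ≡ n
  π-full i i<a = trans (cong suc (count-cong (adj G i) (λ j → not (is i j)) same)) (count-others i)
    where
    same : ∀ j → adj G i j ≡ not (is i j)
    same j = cong (λ v → (v ∨ below a j) ∧ not (is i j)) (below-⇐ {k = a} {i} i<a)

  π-small : ∀ i → a ≤ toℕ i → π i ≡ a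
  π-small i a≤i = trans (count-cong (adj G i) (below a) same) (count-below n a a≤n)
    where
    same : ∀ j → adj G i j ≡ below a j
    same j rewrite dec-false (toℕ i <? a) (≤⇒≯ a≤i) with below a j in e
    ... | false = refl
    ... | true  = cong not (is-≢ {i = i} {j} (λ { refl → <⇒≱ (below-⇒ {k = a} {j} e) a≤i }))

  nonincreasing : Nonincreasing π
  nonincreasing i j i≤j with toℕ i <? a
  ... | no i≮a  = ≤-reflexive (trans (π-small j (≤-trans (≮⇒≥ i≮a) i≤j)) (≡-sym (π-small i (≮⇒≥ i≮a))))
  ... | yes i<a = ≤-pred (subst (suc (π j) ≤_) (≡-sym (π-full i i<a))
                    (subst (π j <_) (count-all {n} (λ _ → true) (λ _ → refl))
                      (count-mono-< (adj G j) (λ _ → true) (λ _ _ → refl) j refl (irrefl G j))))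

  -- The realization is arbitrary, so only degrees can be used: a clique vertex outside the first
  -- `a` would have degree `a`, less than s - 1. Hence the clique would fit into `a` vertices.
  no-clique : ∀ s → suc a < s → ¬ PotentiallyGraphic (K s) π
  no-clique s a<s (H , R , f , inj , clique) = <⇒≱ (<-trans (n<1+n a) a<s)
    (subst (s ≤_) (count-below n a a≤n) (image-size f inj (below a) inside))
    where
    inside : ∀ u → below a (f u) ≡ true
    inside u with toℕ (f u) <? a
    ... | yes lt = below-⇐ {k = a} {f u} lt
    ... | no ¬lt = contradiction (≤-trans (≤-reflexive (≡-sym (count-others u))) (s≤s (begin
      count (λ v → not (is u v))   ≤⟨ count-image f inj (λ v → not (is u v)) (adj H (f u)) (λ v e → clique u v (flip v e)) ⟩
      deg H (f u)                  ≡⟨ R (f u) ⟩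
      π (f u)                      ≡⟨ π-small (f u) (≮⇒≥ ¬lt) ⟩
      a                            ∎))) (<⇒≱ a<s)
      where
      open ≤-Reasoning
      flip : ∀ v → not (is u v) ≡ true → adj (K s) u v ≡ true
      flip v e = cong not (dec-false (u ≟ v) (λ h → does⇏ (v ≟ u) (not⇒ e) (≡-sym h)))

  -- Full degree becomes degree 0 in the complementary sequence, and `T` has no isolated vertex. So
  -- a copy of `T` would have to fit into the other n - a vertices.
  no-spanned : ∀ {t} (T : Graph t) → (∀ u → ∃ λ v → adj T u v ≡ true) → n < a + t →
               ¬ PotentiallyGraphic T (complementSeq π)
  no-spanned {t} T nbr n<a+t (H , R , f , inj , edges) = <⇒≱ n<a+t (begin
    a + t                                           ≤⟨ +-monoʳ-≤ a (image-size (opposite ∘ f) inj' (between a n) inside) ⟩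
    a + count {n} (between a n)                     ≡⟨ count-between n a n a≤n ≤-refl ⟩
    n                                               ∎)
    where
    open ≤-Reasoning
    inj' : Injective _≡_ _≡_ (opposite ∘ f)
    inj' e = inj (trans (≡-sym (opposite-involutive _)) (trans (cong opposite e) (opposite-involutive _)))
    inside : ∀ u → between a n (opposite (f u)) ≡ true
    inside u = between-⇐ (opposite (f u)) (≮⇒≥ outside) (toℕ<n _)
      where
      outside : ¬ (toℕ (opposite (f u)) < a)
      outside lt =
        let v , uv = nbr u
            pos = count-pos (adj H (f u)) (f v) (edges u v uv)
        in n≮0 (≤-trans pos (≤-reflexive (trans (R (f u))
             (trans (cong (λ m → (m ∸ 1) ∸ π (opposite (f u))) (≡-sym (π-full (opposite (f u)) lt))) (n∸n≡0 (π (opposite (f u))))))))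

-- The lower and the upper bound

connected-nbr : ∀ {t} (T : Graph t) → Connected T → 2 ≤ t → ∀ u → ∃ λ v → adj T u v ≡ true
connected-nbr {t} T connected 2≤t u =
  let v , _ , v≢u = count-<⇒∖ (λ _ → true) (is u) (subst₂ _<_ (≡-sym (count-is u)) (≡-sym (count-all {t} (λ _ → true) (λ _ → refl))) 2≤t)
  in first (connected u v) (λ e → does⇏ (v ≟ u) v≢u (≡-sym e))
  where
  first : ∀ {u v} → Reach T u v → u ≢ v → ∃ λ w → adj T u w ≡ true
  first here        u≢u = contradiction refl u≢u
  first (step uw _) _   = _ , uw

-- The number of vertices of full degree is k cut off at n, as n may be smaller than k; the sequence
-- is then that of a complete graph.
lower-bound : ∀ k t (T : Graph t) → Connected T → 2 ≤ t → ∀ n → n < k + t → ¬ RamseyProp (K (2 + k)) T n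
lower-bound k t T connected 2≤t n n<k+t ramsey =
  [ no-clique (2 + k) (s≤s (s≤s a≤k)) , no-spanned T (connected-nbr T connected 2≤t) n<a+t ]
    (ramsey π nonincreasing (G , λ _ → refl))
  where
  a≤k : k ⊓ n ≤ k
  a≤k = m⊓n≤m k n
  open Extremal n (k ⊓ n) (m⊓n≤n k n)
  n<a+t : n < k ⊓ n + t
  n<a+t = subst (n <_) (≡-sym (+-distribʳ-⊓ t k n)) (⊓-pres-m< n<k+t (m<m+n n (<-trans (s≤s z≤n) 2≤t)))

contains-clique : ∀ {n} (G : Graph n) s → s ≤ n → CliqueOn s G → Contains (K s) G
contains-clique {n} G s s≤n clique = f , inj , edges
  where
  f : Fin s → Fin n
  f u = fromℕ< (<-≤-trans (toℕ<n u) s≤n)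
  toℕ-f : ∀ u → toℕ (f u) ≡ toℕ u
  toℕ-f u = toℕ-fromℕ< _
  inj : Injective _≡_ _≡_ f
  inj {u} {v} e = toℕ-injective (trans (≡-sym (toℕ-f u)) (trans (cong toℕ e) (toℕ-f v)))
  edges : ∀ u v → adj (K s) u v ≡ true → adj G (f u) (f v) ≡ true
  edges u v uv = clique (f u) (f v) (subst (_< s) (≡-sym (toℕ-f u)) (toℕ<n u)) (subst (_< s) (≡-sym (toℕ-f v)) (toℕ<n v))
    (λ e → adj-≢ (K s) uv (inj e))

-- An edge is already a `K 2`; a graph without edges has a complete complement, which contains every
-- `T` of the same order.
upper-bound-2 : ∀ t (T : Graph t) → RamseyProp (K 2) T t
upper-bound-2 t T π mono (G , R) with any? (λ i → any? (λ j → adj G i j Bool.≟ true))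
... | yes (i , j , ij) = inj₁ (G , R , f , inj , edges)
  where
  f : Fin 2 → Fin t
  f zero    = i
  f (suc _) = j
  inj : Injective _≡_ _≡_ f
  inj {zero}     {zero}     _ = refl
  inj {zero}     {suc zero} e = contradiction e (adj-≢ G ij)
  inj {suc zero} {zero}     e = contradiction (≡-sym e) (adj-≢ G ij)
  inj {suc zero} {suc zero} _ = refl
  edges : ∀ u v → adj (K 2) u v ≡ true → adj G (f u) (f v) ≡ true
  edges zero       (suc zero) _ = ij
  edges (suc zero) zero       _ = adj-sym G ij
  edges zero       zero       ()
  edges (suc zero) (suc zero) ()
... | no ¬ij = inj₂ (complement-graphic T π G R id id (λ i j _ → ≢true (λ e → ¬ij (i , j , e))))

-- With A and B the two colour classes of deep vertices, (ℓ + |A|) + (ℓ + |B|) ≥ t ≥ 2k + 5, so one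
-- of the two summands is at least k + 3.
deep-colour-class : ∀ {t} (T : Graph t) (tree : IsTree T) k → 2 ≤ t → 5 + (k + k) ≤ t →
  ∃ λ (J : Fin t → Bool) → (∀ i → J i ≡ true → Growth.deep T tree i ≡ true) ×
    (∀ i j → J i ≡ true → J j ≡ true → adj T i j ≡ false) × 3 + k ≤ leaves T + count J
deep-colour-class {t} T tree k 2≤t large = choose (3 + k ≤? ℓ + count A) (3 + k ≤? ℓ + count B)
  where
  open Growth T tree
  ℓ : ℕ
  ℓ = leaves T
  colouring = two-colouring (fromℕ< (<-trans (s≤s z≤n) 2≤t))
  col = proj₁ colouring
  proper = proj₂ colouring
  A B : Fin t → Bool
  A i = col i ∧ deep i
  B i = not (col i) ∧ deep i
  choose : Dec (3 + k ≤ ℓ + count A) → Dec (3 + k ≤ ℓ + count B) →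
    ∃ λ (J : Fin t → Bool) → (∀ i → J i ≡ true → deep i ≡ true) ×
      (∀ i j → J i ≡ true → J j ≡ true → adj T i j ≡ false) × 3 + k ≤ ℓ + count J
  choose (yes h) _ = A , (λ i e → proj₂ (∧⇒ {col i} e)) ,
    (λ i j e e' → ≢true (λ ij → proper i j ij (trans (proj₁ (∧⇒ {col i} e)) (≡-sym (proj₁ (∧⇒ {col j} e')))))) , h
  choose (no _) (yes h) = B , (λ i e → proj₂ (∧⇒ {not (col i)} e)) ,
    (λ i j e e' → ≢true (λ ij → proper i j ij
      (trans (not⇒ (proj₁ (∧⇒ {not (col i)} e))) (≡-sym (not⇒ (proj₁ (∧⇒ {not (col j)} e'))))))) , h
  choose (no h) (no h') = contradiction (begin
    5 + (k + k)                            ≤⟨ large ⟩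
    t                                      ≤⟨ count-deep ⟩
    count deep + (ℓ + ℓ)                   ≡⟨ cong (_+ (ℓ + ℓ)) (count-split deep col) ⟩
    count A + count B + (ℓ + ℓ)            ≡⟨ arith (count A) (count B) ℓ ⟩
    (ℓ + count A) + (ℓ + count B)          ≤⟨ +-mono-≤ (≤-pred (≰⇒> h)) (≤-pred (≰⇒> h')) ⟩
    (2 + k) + (2 + k)                      ≡⟨ arith' k ⟩
    4 + (k + k)                            ∎) 1+n≰n
    where
    open ≤-Reasoning
    arith : ∀ a b l → a + b + (l + l) ≡ (l + a) + (l + b)
    arith = solve-∀
    arith' : ∀ k → (2 + k) + (2 + k) ≡ 4 + (k + k)
    arith' = solve-∀

upper-bound : ∀ k t (T : Graph t) → IsTree T → 3 ≤ t → 3 + k ≤ leaves T ⊎ 5 + (k + k) ≤ t →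
              RamseyProp (K (2 + k)) T (k + t)
upper-bound k t T tree 3≤t many π mono graphic
  with any? (λ i → (3 + (k + k) ≤? toℕ i) ×-dec (k <? π i)) | any? (λ i → (2 + k ≤? toℕ i) ×-dec (suc (k + k) <? π i))
-- A degree above k at index 2s - 1 or later bounds all earlier degrees from below: the first
-- alternative of `ManyOrLarge`.
... | yes (i , 2s≤i , big) | _ = inj₁ (G , R , contains-clique G s s≤N clique)
  where
  s = 2 + k
  arith : ∀ k → (2 + k) + (2 + k) ≡ suc (3 + (k + k))
  arith = solve-∀
  2s≤N : s + s ≤ k + t
  2s≤N = ≤-trans (≤-reflexive (arith k)) (≤-trans (s≤s 2s≤i) (toℕ<n i))
  s≤N = ≤-trans (m≤m+n s s) 2s≤N
  all-big : ∀ j → toℕ j < s + s → s ≤ suc (π j)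
  all-big j j<2s = s≤s (≤-trans big (mono j i (≤-trans (≤-pred (≤-trans j<2s (≤-reflexive (arith k)))) 2s≤i)))
  found = clique-realization π mono graphic s (s≤s z≤n) s≤N
            (λ j j<s → all-big j (≤-trans j<s (m≤m+n s s))) (inj₁ (2s≤N , all-big))
  G = proj₁ found
  R = proj₁ (proj₂ found)
  clique = proj₂ (proj₂ found)
-- Here d_{s+1} is at least 2k + 2 = 2s - 2: the second alternative of `ManyOrLarge`.
... | no _ | yes (i , s≤i , large) = inj₁ (G , R , contains-clique G s s≤N clique)
  where
  s = 2 + k
  s≤N : s ≤ k + t
  s≤N = ≤-trans s≤i (<⇒≤ (toℕ<n i))
  found = clique-realization π mono graphic s (s≤s z≤n) s≤N
            (λ j j<s → s≤s (≤-trans (s≤s (≤-trans (m≤m+n k k) (n≤1+n _))) (≤-trans large (mono j i (≤-trans (<⇒≤ j<s) s≤i)))))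
            (inj₂ (λ j j≡s → ≤-trans (≤-reflexive (arith k)) (s≤s (s≤s (≤-trans large (mono j i (subst (_≤ toℕ i) (≡-sym j≡s) s≤i)))))))
    where
    arith : ∀ k → (2 + k) + (2 + k) ≡ suc (suc (suc (suc (k + k))))
    arith = solve-∀
  G = proj₁ found
  R = proj₁ (proj₂ found)
  clique = proj₂ (proj₂ found)
... | no ¬big | no ¬large =
  let J , J-deep , J-indep , enough = pick many
      ρ , inner = inner-vertex 3≤t
      G , R , f , inj , apart = embedding J-deep J-indep (two-leaves 2≤t) enough ρ inner
  in inj₂ (complement-graphic T π G R f inj apart)
  where
  open Growth T tree
  2≤t : 2 ≤ t
  2≤t = ≤-trans (n≤1+n 2) 3≤t
  pick : 3 + k ≤ leaves T ⊎ 5 + (k + k) ≤ t →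
    ∃ λ (J : Fin t → Bool) → (∀ i → J i ≡ true → deep i ≡ true) ×
      (∀ i j → J i ≡ true → J j ≡ true → adj T i j ≡ false) × 3 + k ≤ leaves T + count J
  pick (inj₁ h) = (λ _ → false) , (λ _ ()) , (λ _ _ ()) , ≤-trans h (m≤m+n _ _)
  pick (inj₂ h) = deep-colour-class T tree k 2≤t h
  open module E {J} = Embed k t T tree π mono graphic
    (λ i h → ≮⇒≥ (λ lt → ¬big (i , h , lt))) (λ i h → ≮⇒≥ (λ lt → ¬large (i , h , lt))) J using (embedding)

Ramsey-number : ∀ k t (T : Graph t) → IsTree T → 3 + k ≤ leaves T ⊎ 7 * k < t → RPotEq (K (2 + k)) T (k + t)
Ramsey-number zero t T tree h = upper-bound-2 t T , below-t t T tree h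
  where
  below-t : ∀ t (T : Graph t) → IsTree T → 3 ≤ leaves T ⊎ 0 < t → ∀ m → m < t → ¬ RamseyProp (K 2) T m
  below-t (suc (suc t)) T tree _ m lt = lower-bound 0 _ T (proj₁ tree) (s≤s (s≤s z≤n)) m lt
  -- For t = 1 only order 0 has to be excluded: the empty graph contains neither `K 2` nor a tree
  -- with one vertex.
  below-t (suc zero) T tree _ zero lt ramsey =
    [ (λ (_ , _ , f , _) → no-vertex (f zero)) , (λ (_ , _ , f , _) → no-vertex (f zero)) ]
      (ramsey (λ ()) (λ ()) (record { adj = λ () ; sym = λ () ; irrefl = λ () } , λ ()))
    where
    no-vertex : ¬ Fin 0
    no-vertex ()
  below-t (suc zero) T tree _ (suc m) (s≤s ())
Ramsey-number (suc k) t T tree h =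
  upper-bound (suc k) t T tree 3≤t (Sum.map₂ large h) ,
  lower-bound (suc k) t T (proj₁ tree) (≤-trans (n≤1+n 2) 3≤t)
  where
  3≤t : 3 ≤ t
  3≤t = [ (λ le → ≤-trans (m≤m+n 3 (suc k)) (≤-trans le (count-≤n _)))
        , (λ lt → ≤-trans (s≤s (s≤s (s≤s z≤n))) (≤-trans (*-monoʳ-≤ 7 (s≤s z≤n)) (<⇒≤ lt))) ] h
  large : 7 * suc k < t → 5 + (suc k + suc k) ≤ t
  large lt = ≤-trans (farkas (1 + 5 * k) z≤n (arith k)) lt
    where
    arith : ∀ k → 5 + (suc k + suc k) + 0 + (1 + 5 * k) ≡ suc (7 * suc k) + 0
    arith = solve-∀

theorem6 : ∀ (s t : ℕ) → 2 ≤ s → (T : Graph t) → IsTree T →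
    (s + 1 ≤ leaves T ⊎ 7 * (s ∸ 2) < t) →
    RPotEq (K s) T (t + s ∸ 2)
theorem6 (suc (suc k)) t (s≤s (s≤s z≤n)) T tree h =
  subst (RPotEq (K (2 + k)) T) (≡-sym order)
    (Ramsey-number k t T tree (Sum.map₁ (≤-trans (≤-reflexive (+-comm 1 (2 + k)))) h))
  where
  order : t + (2 + k) ∸ 2 ≡ k + t
  order = trans (cong (_∸ 2) (trans (+-suc t (suc k)) (cong suc (+-suc t k)))) (+-comm t k)
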